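{- Fix $k\in\{4,8,12\}$, and let $f=f_k$. Let $\bm{w}$ be the infinite word over $\Sigma_k=\{1,2,\dots,k\}$ with prefix $12\cdots(k-1)$ and encoding $t(\bm{w})=g(f^\omega(1))$. Then $\bm{w}$ is undirected $(k-1)/(k-2)^+$-free.
   Context: For a word $x=x_1\cdots x_n$, $x^R=x_n\cdots x_1$ denotes its reversal. For rational $1<r\leq 2$, an undirected $r$-power is a word of the form $xyx'$ with $x$ nonempty, $x'\in\{x,x^R\}$, and $|xyx'|/|xy|=r$. A word is undirected $\alpha^+$-free if none of its factors is an undirected $r$-power with $r>\alpha$. The morphisms $f_4,f_8,f_{12}:\{1,2\}^*\to\{1,2\}^*$ are defined by $f_4(1)=121$, $f_4(2)=122$; $f_8(1)=121212112122121$, $f_8(2)=211212122122112$; $f_{12}(1)=121212121211212122121$, $f_{12}(2)=212122112121121212212$. The morphism $g:\{1,2\}^*\to\{1,2,3\}^*$ is defined by $g(1)=31$, $g(2)=312$. Ternary encoding: let $w\in\Sigma_k^*$ contain at least $k-1$ distinct letters, with every length-$(k-2)$ factor having $k-2$ distinct letters and every length-$k$ factor having at least $k-1$ distinct letters. Let $u$ be the shortest prefix of $w$ containing $k-1$ distinct letters, and write $w=uv$ with $v=v_1\cdots v_n$. Let $p_0=u$ and $p_i=uv_1\cdots v_i$. Each $p_i$ determines a permutation $r_i$ of $\Sigma_k$ ranking the letters by the index of their final appearance in $p_i$: $r_i[3]\cdots r_i[k]$ is the length-$(k-2)$ suffix of $p_i$; of the two remaining letters, $r_i[2]$ is the one appearing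 last in $p_i$, and $r_i[1]$ is the other (it may not appear in $p_i$ at all). Each $v_i$ lies in $\{r_{i-1}[1],r_{i-1}[2],r_{i-1}[3]\}$, and the encoding is $t(w)=t_1\cdots t_n$ with $t_i=j$ when $v_i=r_{i-1}[j]$, $j\in\{1,2,3\}$. The word $w$ is recoverable from $u$ and $t(w)$; this is how $\bm{w}$ is defined from the prefix $12\cdots(k-1)$ and the encoding $g(f^\omega(1))$ (extended to infinite words in the obvious way). -}

module Defs where

open import Data.Nat using (ℕ; zero; suc; _+_; _*_; _∸_; _≤_; _<_; _≤ᵇ_; _≡ᵇ_)
open import Data.Bool using (Bool; true; false; if_then_else_; not)
open import Data.List using (List; []; _∷_; _++_; map; concatMap; length; drop; filter; upTo; reverse)
open import Data.Product using (_×_; _,_)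
open import Data.Sum using (_⊎_)
open import Relation.Binary.PropositionalEquality using (_≡_)
open import Relation.Nullary using (¬_)
open import Relation.Nullary.Decidable using (T?)
open import Data.Bool using (T)

-- Letters are natural numbers; Σ_k = {1,…,k}.  Words are lists of ℕ,
-- infinite words are functions ℕ → ℕ (position 0 = first letter).

nth : List ℕ → ℕ → ℕ
nth []       _       = 0
nth (x ∷ _)  zero    = x
nth (_ ∷ xs) (suc i) = nth xs i

iter : {A : Set} → ℕ → (A → A) → A → A
iter zero    h a = a
iter (suc n) h a = h (iter n h a)

applyMorph : (ℕ → List ℕ) → List ℕ → List ℕ
applyMorph h = concatMap h

f4 : ℕ → List ℕ
f4 1 = 1 ∷ 2 ∷ 1 ∷ []
f4 2 = 1 ∷ 2 ∷ 2 ∷ []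
f4 _ = []

f8 : ℕ → List ℕ
f8 1 = 1 ∷ 2 ∷ 1 ∷ 2 ∷ 1 ∷ 2 ∷ 1 ∷ 1 ∷ 2 ∷ 1 ∷ 2 ∷ 2 ∷ 1 ∷ 2 ∷ 1 ∷ []
f8 2 = 2 ∷ 1 ∷ 1 ∷ 2 ∷ 1 ∷ 2 ∷ 1 ∷ 2 ∷ 2 ∷ 1 ∷ 2 ∷ 2 ∷ 1 ∷ 1 ∷ 2 ∷ []
f8 _ = []

f12 : ℕ → List ℕ
f12 1 = 1 ∷ 2 ∷ 1 ∷ 2 ∷ 1 ∷ 2 ∷ 1 ∷ 2 ∷ 1 ∷ 2 ∷ 1 ∷ 1 ∷ 2 ∷ 1 ∷ 2 ∷ 1 ∷ 2 ∷ 2 ∷ 1 ∷ 2 ∷ 1 ∷ []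
f12 2 = 2 ∷ 1 ∷ 2 ∷ 1 ∷ 2 ∷ 2 ∷ 1 ∷ 1 ∷ 2 ∷ 1 ∷ 2 ∷ 1 ∷ 1 ∷ 2 ∷ 1 ∷ 2 ∷ 1 ∷ 2 ∷ 2 ∷ 1 ∷ 2 ∷ []
f12 _ = []

-- f = f_k  (only meaningful for k ∈ {4,8,12}; other k give a dummy morphism)
fOf : ℕ → ℕ → List ℕ
fOf 4  = f4
fOf 8  = f8
fOf 12 = f12
fOf _  = f4

g : ℕ → List ℕ
g 1 = 3 ∷ 1 ∷ []
g 2 = 3 ∷ 1 ∷ 2 ∷ []
g _ = []

-- The infinite encoding word g(f^ω(1)), 0-indexed: its i-th letter is the
-- i-th letter of g(f^(i+1)(1)), which is a prefix of g(f^ω(1)) of length > i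
-- (since f(1) begins with 1 and |f(a)| ≥ 3).
encoding : ℕ → ℕ → ℕ
encoding k i = nth (applyMorph g (iter (suc i) (applyMorph (fOf k)) (1 ∷ []))) i

elemB : ℕ → List ℕ → Bool
elemB a []       = false
elemB a (x ∷ xs) = if a ≡ᵇ x then true else elemB a xs

-- lastPos a p = 1 + index of the final occurrence of a in p, or 0 if a ∉ p.
lastPosAux : ℕ → ℕ → List ℕ → ℕ → ℕ
lastPosAux a i []       acc = acc
lastPosAux a i (x ∷ xs) acc = lastPosAux a (suc i) xs (if a ≡ᵇ x then suc i else acc)

lastPos : ℕ → List ℕ → ℕ
lastPos a p = lastPosAux a 0 p 0

alphabet : ℕ → List ℕ
alphabet k = map suc (upTo k)

suffix : ℕ → List ℕ → List ℕ
suffix m p = drop (length p ∸ m) p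

-- The ranking permutation r determined by a prefix p, as the list
-- r[1] r[2] r[3] … r[k]: r[3]⋯r[k] is the length-(k-2) suffix of p; of the
-- two remaining letters a,b, r[2] is the one whose final appearance in p is
-- later, and r[1] is the other.
rank : ℕ → List ℕ → List ℕ
rank k p with filter (λ a → T? (not (elemB a (suffix (k ∸ 2) p)))) (alphabet k)
... | a ∷ b ∷ [] = if lastPos b p ≤ᵇ lastPos a p
                     then b ∷ a ∷ suffix (k ∸ 2) p
                     else a ∷ b ∷ suffix (k ∸ 2) p
... | _ = suffix (k ∸ 2) p   -- does not occur in the situations considered

rankLetter : ℕ → List ℕ → ℕ → ℕ
rankLetter k p j = nth (rank k p) (j ∸ 1)

-- p_n = u v_1 ⋯ v_n with u = 1 2 ⋯ (k-1) and v_{n+1} = r_n[t_{n+1}],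
-- where t is the encoding word.
prefixP : ℕ → (ℕ → ℕ) → ℕ → List ℕ
prefixP k t zero    = map suc (upTo (k ∸ 1))
prefixP k t (suc n) = prefixP k t n ++ (rankLetter k (prefixP k t n) (t n) ∷ [])

-- The infinite word decoded from the prefix 1 2 ⋯ (k-1) and encoding t;
-- its n-th letter (0-indexed) is the n-th letter of p_n (|p_n| = k-1+n).
decode : ℕ → (ℕ → ℕ) → ℕ → ℕ
decode k t n = nth (prefixP k t n) n

wordW : ℕ → ℕ → ℕ
wordW k = decode k (encoding k)

factor : (ℕ → ℕ) → ℕ → ℕ → List ℕ
factor w i n = map (λ j → w (i + j)) (upTo n)

-- The factor of w at position i of length 2a+b, written x y x' with
-- |x| = |x'| = a ≥ 1, |y| = b, is an undirected power (x' ∈ {x, x^R}),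
-- of exponent (2a+b)/(a+b).
UndirectedPowerAt : (ℕ → ℕ) → ℕ → ℕ → ℕ → Set
UndirectedPowerAt w i a b =
  1 ≤ a × (factor w (i + a + b) a ≡ factor w i a ⊎ factor w (i + a + b) a ≡ reverse (factor w i a))

-- w is undirected (num/den)^+-free: no factor is an undirected r-power with
-- r > num/den, where r = (2a+b)/(a+b) > num/den  ⇔  num·(a+b) < (2a+b)·den.
UndirectedFreePlus : ℕ → ℕ → (ℕ → ℕ) → Set
UndirectedFreePlus num den w =
  ∀ i a b → num * (a + b) < (2 * a + b) * den → ¬ UndirectedPowerAt w i a b

{-# OPTIONS --safe #-}
module Submission where

-- Write F = f^ω(1) and let S n be the ranking of the letters of w before the
-- n-th letter of the encoding T = g(F) is read; reading a letter permutes S n.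
-- The letter 3 marks the equalities w(n+1) = w(n+k-1), so both kinds of powers
-- leave a trace in the positions of the 3s, that is, in F.
--   * A long mirrored pair x, x^R would give a long factor of the 3-positions
--     whose mirror image is again a factor; there is none.
--   * A long repetition in w gives a kernel repetition in F: a repetition with
--     the same ranking at both occurrences.  Every f(a) has the same length L,
--     long factors of F determine their position modulo L, and the action of
--     f(a) on rankings is conjugate to that of a.  So long kernel repetitions
--     desubstitute to shorter ones with proportionally smaller period, and the
--     ratio of length to period is bounded by its values on short ones.
-- What remains are finitely many lengths, and every short factor of w is, up to
-- renaming letters, visible in the word encoded by g(f^j(ab)) for letters a, b.

open import Defs
open import Data.Bool using (Bool; true; false; if_then_else_; not; _∨_)
import Data.Bool as Bool
open import Data.Bool.ListAction using (all)
open import Data.Empty using (⊥; ⊥-elim)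
open import Data.List using (List; []; _∷_; _++_; map; length; take; drop; upTo; applyUpTo; reverse; concatMap; deduplicate; filter; foldr)
open import Data.List.Membership.Propositional using (_∈_; lose)
open import Data.List.Membership.Propositional.Properties using (∈-map⁺; ∈-concatMap⁺; ∈-deduplicate⁺; ∈-upTo⁺)
open import Data.List.Properties using (≡-dec; ++-assoc; ++-identityʳ; ∷ʳ-injective; concatMap-++; drop-map; filter-accept; filter-none; length-++; length-drop; length-map; length-reverse; length-take; length-upTo; map-++; map-cong-local; map-id-local; map-upTo; map-∘; unfold-reverse)
open import Data.List.Relation.Binary.Permutation.Propositional using (_↭_; prep; ↭-sym; ↭-trans)
open import Data.List.Relation.Binary.Permutation.Propositional.Properties using (All-resp-↭; drop-∷; filter-↭; ∈-resp-↭; ∷↭∷ʳ; ↭-length; ↭-singleton-inv)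
open import Data.List.Relation.Unary.All using (All; []; _∷_)
import Data.List.Relation.Unary.All as All
import Data.List.Relation.Unary.All.Properties as All
open import Data.List.Relation.Unary.AllPairs using (AllPairs; []; _∷_; allPairs?)
import Data.List.Relation.Unary.AllPairs as AllPairs
import Data.List.Relation.Unary.AllPairs.Properties as AllPairs
open import Data.List.Relation.Unary.Any using (here; there)
open import Data.Nat using (ℕ; zero; suc; pred; _+_; _*_; _∸_; _^_; _⊔_; _≤_; _<_; z≤n; s≤s; _≡ᵇ_; _≤ᵇ_; NonZero; >-nonZero)
open import Data.Nat.DivMod using (_/_; _%_; m≡m%n+[m/n]*n; m%n<n; m<n*o⇒m/o<n; m/n*n≤m; m≥n⇒m/n>0)
open import Data.Nat.Induction using (<-wellFounded)
open import Data.Nat.ListAction using (sum)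
open import Data.Nat.ListAction.Properties using (sum-↭)
open import Data.Nat.Properties
open import Data.Nat.Solver using (module +-*-Solver)
open import Data.Product using (Σ; ∃; ∃₂; _×_; _,_; proj₁; proj₂)
open import Data.Sum using (_⊎_; inj₁; inj₂)
open import Data.Unit using (⊤; tt)
open import Data.Vec using (Vec; []; _∷_; toList; fromList)
open import Data.Vec.Properties using (toList∘fromList)
open import Function using (_∘_)
open import Induction.WellFounded using (Acc; acc)
open import Relation.Binary.PropositionalEquality
open import Relation.Nullary using (¬_; Dec; yes; no)
open import Relation.Nullary.Decidable using (T?; toWitness; _⊎-dec_)

-- For a factor x y x′ with `a` = |x| and period p = |xy|, the condition r > (k-1)/(k-2) says p <
-- (k-2) a. Passing from w to F is lossy: consecutive 3s are two or three places apart, so p and `a`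
-- turn into numbers of 3s at different rates, and the ends of a repetition lose up to about k
-- letters. The kernel bound on F must therefore beat the ratio 1/(k-2) by a factor above 3/2. The
-- field `slack` measures that margin, and the loss at the ends is absorbed by the threshold `a₀`.
-- The bound concerns ℓ + 1 instead of ℓ because desubstitution drops incomplete blocks, and only
-- with the 1 does the inequality come back unchanged. One argument serves the three alphabets:
-- whatever depends on k is a field of `Certificate`, and its Boolean fields are closed
-- computations.

private variable
  A : Set

-- Occurrences of finite words in infinite ones, and limits of prefixes

nth-++ˡ : ∀ (u v : List ℕ) {i} → i < length u → nth (u ++ v) i ≡ nth u i
nth-++ˡ (x ∷ u) v {zero}  _         = refl
nth-++ˡ (x ∷ u) v {suc i} (s≤s i<u) = nth-++ˡ u v i<u

-- Recursion on the list, not a quantifier over positions: matching an occurrence with `refl`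
-- identifies its letters one at a time.
Occ : (ℕ → A) → ℕ → List A → Set
Occ w i []      = ⊤
Occ w i (x ∷ u) = w i ≡ x × Occ w (suc i) u

occ-nth : ∀ {w : ℕ → ℕ} {i} u → Occ w i u → ∀ {j} → j < length u → w (i + j) ≡ nth u j
occ-nth {w} {i} (x ∷ u) (eq , _)  {zero}  _         = trans (cong w (+-identityʳ i)) eq
occ-nth {w} {i} (x ∷ u) (_ , occ) {suc j} (s≤s j<u) = trans (cong w (+-suc i j)) (occ-nth u occ j<u)

nth-occ : ∀ {w : ℕ → ℕ} {i} u → (∀ {j} → j < length u → w (i + j) ≡ nth u j) → Occ w i u
nth-occ             []      eq = tt
nth-occ {w} {i} (x ∷ u) eq =
  trans (cong w (sym (+-identityʳ i))) (eq (s≤s z≤n)) ,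
  nth-occ u (λ {j} j<u → trans (cong w (sym (+-suc i j))) (eq (s≤s j<u)))

occ-++ : ∀ {w : ℕ → A} {i} u {v} → Occ w i u → Occ w (i + length u) v → Occ w i (u ++ v)
occ-++ {w = w} {i} []      {v} _          occᵥ = subst (λ n → Occ w n v) (+-identityʳ i) occᵥ
occ-++ {w = w} {i} (x ∷ u) {v} (eq , occ) occᵥ =
  eq , occ-++ u occ (subst (λ n → Occ w n v) (+-suc i (length u)) occᵥ)

occ-++ˡ : ∀ {w : ℕ → A} {i} u {v} → Occ w i (u ++ v) → Occ w i u
occ-++ˡ []      _          = tt
occ-++ˡ (x ∷ u) (eq , occ) = eq , occ-++ˡ u occ

occ-++ʳ : ∀ {w : ℕ → A} {i} u {v} → Occ w i (u ++ v) → Occ w (i + length u) v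
occ-++ʳ {w = w} {i} []      {v} occ       = subst (λ n → Occ w n v) (sym (+-identityʳ i)) occ
occ-++ʳ {w = w} {i} (x ∷ u) {v} (_ , occ) =
  subst (λ n → Occ w n v) (sym (+-suc i (length u))) (occ-++ʳ u occ)

occ-drop : ∀ {w : ℕ → A} {i} n u → Occ w i u → Occ w (i + n) (drop n u)
occ-drop {w = w} {i} zero    u       occ       = subst (λ n → Occ w n u) (sym (+-identityʳ i)) occ
occ-drop             (suc n) []      occ       = tt
occ-drop {w = w} {i} (suc n) (x ∷ u) (_ , occ) =
  subst (λ m → Occ w m (drop n u)) (sym (+-suc i n)) (occ-drop n u occ)

occ-take : ∀ {w : ℕ → A} {i} n u → Occ w i u → Occ w i (take n u)
occ-take zero    u       occ        = tt
occ-take (suc n) []      occ        = tt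
occ-take (suc n) (x ∷ u) (eq , occ) = eq , occ-take n u occ

split-at : ∀ (u : List ℕ) {n} → n < length u →
           Σ (List ℕ) λ a → Σ (List ℕ) λ b → u ≡ a ++ nth u n ∷ b × length a ≡ n
split-at (x ∷ u) {zero}  _         = [] , u , refl , refl
split-at (x ∷ u) {suc n} (s≤s n<u) with split-at u n<u
... | a , b , eq , len = x ∷ a , b , cong (x ∷_) eq , cong suc len

-- The limit is taken along the diagonal because `encoding` and `decode` are defined that way; their
-- instances below then agree with them by definition.
module Limit (u : ℕ → List ℕ) (grow : ∀ n → ∃ λ v → u (suc n) ≡ u n ++ v)
             (long : ∀ n → n < length (u n)) where

  limit : ℕ → ℕ
  limit n = nth (u n) n

  private
    extend : ∀ d n → ∃ λ v → u (d + n) ≡ u n ++ v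
    extend zero    n = [] , sym (++-identityʳ (u n))
    extend (suc d) n with extend d n | grow (d + n)
    ... | v , eq | v′ , eq′ = v ++ v′ , trans eq′ (trans (cong (_++ v′) eq) (++-assoc (u n) v v′))

    nth-later : ∀ {m n i} → m ≤ n → i < length (u m) → nth (u n) i ≡ nth (u m) i
    nth-later {m} {n} {i} m≤n i<u with extend (n ∸ m) m
    ... | v , eq = trans (cong (λ x → nth x i) (trans (cong u (sym (m∸n+n≡m m≤n))) eq)) (nth-++ˡ (u m) v i<u)

  limit-prefix : ∀ n → Occ limit 0 (u n)
  limit-prefix n = nth-occ (u n) at
    where
    at : ∀ {i} → i < length (u n) → limit i ≡ nth (u n) i
    at {i} i<u with ≤-total i n
    ... | inj₁ i≤n = sym (nth-later i≤n (long i))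
    ... | inj₂ n≤i = nth-later n≤i i<u

-- Uniform morphisms and their fixed point

Binary : ℕ → Set
Binary x = x ≡ 1 ⊎ x ≡ 2

binary-nth : ∀ {u} → All Binary u → ∀ {i} → i < length u → Binary (nth u i)
binary-nth (b ∷ _)  {zero}  _         = b
binary-nth (_ ∷ bs) {suc i} (s≤s i<u) = binary-nth bs i<u

record Uniform (f : ℕ → List ℕ) (L : ℕ) : Set where
  field
    2≤L    : 2 ≤ L
    f-len  : ∀ {x} → Binary x → length (f x) ≡ L
    f-bin  : ∀ {x} → Binary x → All Binary (f x)
    f-head : ∃ λ v → f 1 ≡ 1 ∷ v

  f* : List ℕ → List ℕ
  f* = applyMorph f

  f*-bin : ∀ {u} → All Binary u → All Binary (f* u)
  f*-bin []       = []
  f*-bin (b ∷ bs) = All.++⁺ (f-bin b) (f*-bin bs)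

  f*-len : ∀ {u} → All Binary u → length (f* u) ≡ L * length u
  f*-len []                 = sym (*-zeroʳ L)
  f*-len {x ∷ u} (b ∷ bs) = begin
    length (f x ++ f* u)          ≡⟨ length-++ (f x) ⟩
    length (f x) + length (f* u)  ≡⟨ cong₂ _+_ (f-len b) (f*-len bs) ⟩
    L + L * length u              ≡⟨ sym (*-suc L (length u)) ⟩
    L * suc (length u)            ∎
    where open ≡-Reasoning

module FixedPoint {f : ℕ → List ℕ} {L : ℕ} (uniform : Uniform f L) where

  open Uniform uniform

  u : ℕ → List ℕ
  u n = iter n f* (1 ∷ [])

  u-bin : ∀ n → All Binary (u n)
  u-bin zero    = inj₁ refl ∷ []
  u-bin (suc n) = f*-bin (u-bin n)

  u-grow : ∀ n → ∃ λ v → u (suc n) ≡ u n ++ v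
  u-grow zero    = proj₁ f-head , trans (++-identityʳ (f 1)) (proj₂ f-head)
  u-grow (suc n) with u-grow n
  ... | v , eq = f* v , trans (cong f* eq) (concatMap-++ f (u n) v)

  u-long : ∀ n → n < length (u n)
  u-long zero    = s≤s z≤n
  u-long (suc n) = begin-strict
    suc n                ≤⟨ u-long n ⟩
    length (u n)         <⟨ m<m+n (length (u n)) (≤-<-trans z≤n (u-long n)) ⟩
    length (u n) + length (u n)  ≡⟨ cong (length (u n) +_) (sym (+-identityʳ _)) ⟩
    2 * length (u n)     ≤⟨ *-monoˡ-≤ (length (u n)) 2≤L ⟩
    L * length (u n)     ≡⟨ sym (f*-len (u-bin n)) ⟩
    length (u (suc n))   ∎
    where open ≤-Reasoning

  open Limit u u-grow u-long using () renaming (limit to F; limit-prefix to F-prefix) public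

  F-bin : ∀ n → Binary (F n)
  F-bin n = binary-nth (u-bin n) (u-long n)

  -- `u (suc n)` is the image of `u n`, and by uniformity the part of `u n` before position `n` has
  -- an image of length `L * n`.
  occ-f : ∀ n → Occ F (L * n) (f (F n))
  occ-f n with split-at (u n) (u-long n)
  ... | a , b , eq , refl =
    subst (λ m → Occ F m (f (F n))) (f*-len (All.++⁻ˡ a (subst (All Binary) eq (u-bin n))))
      (occ-++ˡ (f (F n)) (occ-++ʳ (f* a) (subst (Occ F 0) eq′ (F-prefix (suc n)))))
    where
    eq′ : u (suc n) ≡ f* a ++ f (F n) ++ f* b
    eq′ = trans (cong f* eq) (concatMap-++ f a (F n ∷ b))

-- The encoding word and the positions of its 3s

Code : ℕ → Set
Code t = t ≡ 1 ⊎ t ≡ 2 ⊎ t ≡ 3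

g* : List ℕ → List ℕ
g* = applyMorph g

g-len : ℕ → ℕ
g-len x = length (g x)

2≤g-len : ∀ {x} → Binary x → 2 ≤ g-len x
2≤g-len (inj₁ refl) = s≤s (s≤s z≤n)
2≤g-len (inj₂ refl) = s≤s (s≤s z≤n)

g-len≤3 : ∀ {x} → Binary x → g-len x ≤ 3
g-len≤3 (inj₁ refl) = s≤s (s≤s z≤n)
g-len≤3 (inj₂ refl) = s≤s (s≤s (s≤s z≤n))

g*-long : ∀ {v} → All Binary v → length v ≤ length (g* v)
g*-long []                = z≤n
g*-long {x ∷ v} (b ∷ bs) = subst (suc (length v) ≤_) (sym (length-++ (g x)))
  (+-mono-≤ (≤-trans (s≤s z≤n) (2≤g-len b)) (g*-long bs))

module Gaps (F : ℕ → ℕ) where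

  -- Start of the block `g (F m)` in the encoding. Each `g x` begins with its only 3, so `G`
  -- enumerates the positions of the 3s.
  G : ℕ → ℕ
  G zero    = 0
  G (suc m) = G m + g-len (F m)

  G-occ : ∀ {m} v → Occ F m v → G (m + length v) ≡ G m + length (g* v)
  G-occ {m} []      _            = trans (cong G (+-identityʳ m)) (sym (+-identityʳ (G m)))
  G-occ {m} (x ∷ v) (refl , occ) = begin
    G (m + suc (length v))                     ≡⟨ cong G (+-suc m (length v)) ⟩
    G (suc m + length v)                       ≡⟨ G-occ v occ ⟩
    G m + g-len (F m) + length (g* v)          ≡⟨ +-assoc (G m) _ _ ⟩
    G m + (g-len (F m) + length (g* v))        ≡⟨ cong (G m +_) (sym (length-++ (g (F m)))) ⟩
    G m + length (g* (F m ∷ v))                ∎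
    where open ≡-Reasoning

module Encoding {f : ℕ → List ℕ} {L : ℕ} (uniform : Uniform f L) where

  open FixedPoint uniform public
  open Gaps F

  -- The shift to `suc n` matches the `suc i` in the definition of `encoding`.
  open Limit (λ n → g* (u (suc n)))
             (λ n → g* (proj₁ (u-grow (suc n))) ,
                    trans (cong g* (proj₂ (u-grow (suc n)))) (concatMap-++ g (u (suc n)) _))
             (λ n → ≤-trans (<-trans (n<1+n n) (u-long (suc n))) (g*-long (u-bin (suc n))))
    renaming (limit to T; limit-prefix to T-prefix) public

  occ-g : ∀ m → Occ T (G m) (g (F m))
  occ-g m with u-grow m
  ... | v , grow with split-at (u m) (u-long m)
  ... | a , b , eq , refl =
    subst (λ n → Occ T n (g (F (length a)))) (sym (G-occ a (occ-++ˡ a (subst (Occ F 0) eq (F-prefix m)))))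
      (occ-++ˡ (g (F m)) (occ-++ʳ (g* a) (occ-++ˡ (g* a ++ g (F m) ++ g* b) (subst (Occ T 0) eq′ (T-prefix m)))))
    where
    eq′ : g* (u (suc m)) ≡ (g* a ++ g (F m) ++ g* b) ++ g* v
    eq′ = trans (cong g* (trans grow (cong (_++ v) eq)))
            (trans (concatMap-++ g (a ++ F m ∷ b) v) (cong (_++ g* v) (concatMap-++ g a (F m ∷ b))))

-- `F` and `T` are parameters known only through two local laws, so no goal from here on can unfold
-- into iterates of the morphism.
module Coded {f : ℕ → List ℕ} {L : ℕ} {F T : ℕ → ℕ} (uniform : Uniform f L) (F-bin : ∀ n → Binary (F n))
             (occ-f : ∀ n → Occ F (L * n) (f (F n))) (occ-g : ∀ m → Occ T (Gaps.G F m) (g (F m))) where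

  open Uniform uniform public
  open Gaps F public

  occ-f* : ∀ {n} v → Occ F n v → Occ F (L * n) (f* v)
  occ-f*     []      _            = tt
  occ-f* {n} (x ∷ v) (refl , occ) =
    occ-++ (f (F n)) (occ-f n) (subst (λ m → Occ F m (f* v)) eq (occ-f* v occ))
    where
    eq : L * suc n ≡ L * n + length (f (F n))
    eq = trans (*-suc L n) (trans (+-comm L (L * n)) (cong (L * n +_) (sym (f-len (F-bin n)))))

  occ-iter : ∀ j {n} v → Occ F n v → Occ F (L ^ j * n) (iter j f* v)
  occ-iter zero    {n} v occ = subst (λ m → Occ F m v) (sym (+-identityʳ n)) occ
  occ-iter (suc j) {n} v occ =
    subst (λ m → Occ F m (f* (iter j f* v))) (sym (*-assoc L (L ^ j) n)) (occ-f* _ (occ-iter j v occ))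

  iter-len : ∀ j {v} → All Binary v → length (iter j f* v) ≡ L ^ j * length v
  iter-len j {v} bs = go j
    where
    bin : ∀ j → All Binary (iter j f* v)
    bin zero    = bs
    bin (suc j) = f*-bin (bin j)
    go : ∀ j → length (iter j f* v) ≡ L ^ j * length v
    go zero    = sym (+-identityʳ _)
    go (suc j) = trans (f*-len (bin j)) (trans (cong (L *_) (go j)) (sym (*-assoc L (L ^ j) (length v))))

  occ-g* : ∀ {m} v → Occ F m v → Occ T (G m) (g* v)
  occ-g*     []      _            = tt
  occ-g* {m} (x ∷ v) (refl , occ) = occ-++ (g (F m)) (occ-g m) (occ-g* v occ)

  G-mono : ∀ {m n} → m ≤ n → G m ≤ G n
  G-mono {m} {n} m≤n with m≤n⇒m<n∨m≡n m≤n
  ... | inj₂ refl = ≤-refl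
  G-mono {m} {suc n} _ | inj₁ (s≤s m≤n) = ≤-trans (G-mono m≤n) (m≤m+n (G n) _)

  G-cancel-< : ∀ {m n} → G m < G n → m < n
  G-cancel-< {m} {n} lt with m <? n
  ... | yes m<n = m<n
  ... | no  m≮n = ⊥-elim (<⇒≱ lt (G-mono (≮⇒≥ m≮n)))

  G-lower : ∀ m q → G m + 2 * q ≤ G (m + q)
  G-lower m zero    = ≤-reflexive (trans (+-identityʳ (G m)) (cong G (sym (+-identityʳ m))))
  G-lower m (suc q) = begin
    G m + 2 * suc q              ≡⟨ cong (G m +_) (trans (*-suc 2 q) (+-comm 2 (2 * q))) ⟩
    G m + (2 * q + 2)            ≡⟨ sym (+-assoc (G m) (2 * q) 2) ⟩
    G m + 2 * q + 2              ≤⟨ +-mono-≤ (G-lower m q) (2≤g-len (F-bin (m + q))) ⟩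
    G (suc (m + q))              ≡⟨ cong G (sym (+-suc m q)) ⟩
    G (m + suc q)                ∎
    where open ≤-Reasoning

  G-upper : ∀ m q → G (m + q) ≤ G m + 3 * q
  G-upper m zero    = ≤-reflexive (trans (cong G (+-identityʳ m)) (sym (+-identityʳ (G m))))
  G-upper m (suc q) = begin
    G (m + suc q)                ≡⟨ cong G (+-suc m q) ⟩
    G (suc (m + q))              ≤⟨ +-mono-≤ (G-upper m q) (g-len≤3 (F-bin (m + q))) ⟩
    G m + 3 * q + 3              ≡⟨ +-assoc (G m) (3 * q) 3 ⟩
    G m + (3 * q + 3)            ≡⟨ cong (G m +_) (trans (+-comm (3 * q) 3) (sym (*-suc 3 q))) ⟩
    G m + 3 * suc q              ∎
    where open ≤-Reasoning

  locate : ∀ n → ∃₂ λ m o → n ≡ G m + o × o < g-len (F m)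
  locate zero    = 0 , 0 , refl , ≤-trans (s≤s z≤n) (2≤g-len (F-bin 0))
  locate (suc n) with locate n
  ... | m , o , eq , o< with suc o <? g-len (F m)
  ... | yes o′< = m , suc o , trans (cong suc eq) (sym (+-suc (G m) o)) , o′<
  ... | no  o′≮ = suc m , 0 ,
    trans (cong suc eq) (trans (sym (+-suc (G m) o)) (trans (cong (G m +_) (≤-antisym o< (≮⇒≥ o′≮))) (sym (+-identityʳ _)))) ,
    ≤-trans (s≤s z≤n) (2≤g-len (F-bin (suc m)))

  T-nth : ∀ m {o} → o < g-len (F m) → T (G m + o) ≡ nth (g (F m)) o
  T-nth m = occ-nth (g (F m)) (occ-g m)

  T-G : ∀ m → T (G m) ≡ 3
  T-G m with F m | F-bin m | occ-g m
  ... | _ | inj₁ refl | eq , _ = eq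
  ... | _ | inj₂ refl | eq , _ = eq

  T-G+1 : ∀ m → T (suc (G m)) ≡ 1
  T-G+1 m with F m | F-bin m | occ-g m
  ... | _ | inj₁ refl | _ , eq , _ = eq
  ... | _ | inj₂ refl | _ , eq , _ = eq

  -- `g 1` has length 2 and is followed by the next 3, while `g 2` has a 2 in that place: the 3s
  -- alone determine F.
  T-G+2 : ∀ {m} → T (G m + 2) ≡ 3 → F m ≡ 1
  T-G+2 {m} eq with F-bin m
  ... | inj₁ Fm≡1 = Fm≡1
  ... | inj₂ Fm≡2 with trans (sym eq) (trans (T-nth m (subst (λ x → 2 < g-len x) (sym Fm≡2) ≤-refl)) (cong (λ x → nth (g x) 2) Fm≡2))
  ... | ()

  G+2 : ∀ {m} → F m ≡ 1 → G m + 2 ≡ G (suc m)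
  G+2 {m} eq = cong (λ x → G m + g-len x) (sym eq)

  T-code : ∀ n → Code (T n)
  T-code n with locate n
  ... | m , o , refl , o< = subst Code (sym (T-nth m o<)) (code (F-bin m) o<)
    where
    code : ∀ {x o} → Binary x → o < g-len x → Code (nth (g x) o)
    code {o = 0} (inj₁ refl) _ = inj₂ (inj₂ refl)
    code {o = 1} (inj₁ refl) _ = inj₁ refl
    code {o = suc (suc _)} (inj₁ refl) (s≤s (s≤s ()))
    code {o = 0} (inj₂ refl) _ = inj₂ (inj₂ refl)
    code {o = 1} (inj₂ refl) _ = inj₁ refl
    code {o = 2} (inj₂ refl) _ = inj₂ (inj₁ refl)
    code {o = suc (suc (suc _))} (inj₂ refl) (s≤s (s≤s (s≤s ())))

  T≡3⇒G : ∀ {n} → T n ≡ 3 → ∃ λ m → n ≡ G m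
  T≡3⇒G {n} eq with locate n
  ... | m , zero , n≡ , o<  = m , trans n≡ (+-identityʳ (G m))
  ... | m , suc o , n≡ , o< = ⊥-elim (no3 (F-bin m) o< (trans (sym (T-nth m o<)) (trans (cong T (sym n≡)) eq)))
    where
    no3 : ∀ {x o} → Binary x → suc o < g-len x → nth (g x) (suc o) ≢ 3
    no3 {o = 0} (inj₁ refl) _ ()
    no3 {o = suc _} (inj₁ refl) (s≤s (s≤s ()))
    no3 {o = 0} (inj₂ refl) _ ()
    no3 {o = 1} (inj₂ refl) _ ()
    no3 {o = suc (suc _)} (inj₂ refl) (s≤s (s≤s (s≤s ())))

  no-33 : ∀ {n} → T (suc n) ≡ 3 → T n ≢ 3
  no-33 {n} eq eq′ with T≡3⇒G {n} eq′
  ... | m , refl with trans (sym eq) (T-G+1 m)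
  ... | ()

  next-G : ∀ i → ∃ λ m → i ≤ G m × G m ≤ 2 + i
  next-G i with locate i
  ... | m , zero  , eq , _  = m , ≤-reflexive (trans eq (+-identityʳ (G m))) ,
                              ≤-trans (≤-reflexive (sym (trans eq (+-identityʳ (G m))))) (m≤n+m i 2)
  ... | m , suc o , eq , o< = suc m , subst (_≤ G (suc m)) (sym eq) (+-monoʳ-≤ (G m) (<⇒≤ o<)) ,
      (begin
        G m + g-len (F m)   ≤⟨ +-monoʳ-≤ (G m) (g-len≤3 (F-bin m)) ⟩
        G m + 3             ≤⟨ +-monoʳ-≤ (G m) (s≤s (s≤s (s≤s (z≤n {o})))) ⟩
        G m + (2 + suc o)   ≡⟨ +-comm (G m) (2 + suc o) ⟩
        2 + (suc o + G m)   ≡⟨ cong (2 +_) (trans (+-comm (suc o) (G m)) (sym eq)) ⟩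
        2 + i               ∎)
    where open ≤-Reasoning

-- Rankings as states, and decoding as their evolution

mv : ℕ → List ℕ → List ℕ
mv 1 (a ∷ s)         = s ++ a ∷ []
mv 2 (a ∷ b ∷ s)     = a ∷ s ++ b ∷ []
mv 3 (a ∷ b ∷ c ∷ s) = a ∷ b ∷ s ++ c ∷ []
mv _ s               = s

≡ᵇ-refl : ∀ n → (n ≡ᵇ n) ≡ true
≡ᵇ-refl zero    = refl
≡ᵇ-refl (suc n) = ≡ᵇ-refl n

≢⇒≡ᵇ : ∀ {m n} → m ≢ n → (m ≡ᵇ n) ≡ false
≢⇒≡ᵇ {zero}  {zero}  ne = ⊥-elim (ne refl)
≢⇒≡ᵇ {zero}  {suc n} ne = refl
≢⇒≡ᵇ {suc m} {zero}  ne = refl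
≢⇒≡ᵇ {suc m} {suc n} ne = ≢⇒≡ᵇ (ne ∘ cong suc)

lastPosAux-snoc : ∀ a i p y e → lastPosAux a i (p ++ y ∷ []) e ≡
                  (if a ≡ᵇ y then suc (i + length p) else lastPosAux a i p e)
lastPosAux-snoc a i []      y e rewrite +-identityʳ i = refl
lastPosAux-snoc a i (x ∷ p) y e rewrite +-suc i (length p) = lastPosAux-snoc a (suc i) p y _

lastPosAux-bound : ∀ a i p e → e ≤ i → lastPosAux a i p e ≤ i + length p
lastPosAux-bound a i []      e e≤i = ≤-trans e≤i (≤-reflexive (sym (+-identityʳ i)))
lastPosAux-bound a i (x ∷ p) e e≤i rewrite +-suc i (length p) with a ≡ᵇ x
... | true  = lastPosAux-bound a (suc i) p (suc i) ≤-refl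
... | false = lastPosAux-bound a (suc i) p e (m≤n⇒m≤1+n e≤i)

lastPos-self : ∀ y p → lastPos y (p ++ y ∷ []) ≡ suc (length p)
lastPos-self y p rewrite lastPosAux-snoc y 0 p y 0 | ≡ᵇ-refl y = refl

lastPos-other : ∀ {x y} p → x ≢ y → lastPos x (p ++ y ∷ []) ≡ lastPos x p
lastPos-other {x} {y} p x≢y rewrite lastPosAux-snoc x 0 p y 0 | ≢⇒≡ᵇ x≢y = refl

-- Strictness makes the letters distinct and allows at most one of them, the first, to be absent
-- from `p`, since an absent letter has last position 0.
ByRecency : List ℕ → List ℕ → Set
ByRecency p = AllPairs (λ a b → lastPos a p < lastPos b p)

recency-distinct : ∀ {p s} → ByRecency p s → AllPairs _≢_ s
recency-distinct {p} = AllPairs.map (λ lt eq → <⇒≢ lt (cong (λ x → lastPos x p) eq))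

recency-snoc : ∀ {p y s} → ByRecency p s → All (_≢ y) s → ByRecency (p ++ y ∷ []) (s ++ y ∷ [])
recency-snoc {p} {y} sorted ne = AllPairs.++⁺ (keep sorted ne) ([] ∷ []) (All.map last ne)
  where
  keep : ∀ {s} → ByRecency p s → All (_≢ y) s → ByRecency (p ++ y ∷ []) s
  keep []       []        = []
  keep {x ∷ s} (lt ∷ srt) (x≢y ∷ ne) = All.zipWith
    (λ (x<z , z≢y) → subst₂ _<_ (sym (lastPos-other p x≢y)) (sym (lastPos-other p z≢y)) x<z) (lt , ne) ∷ keep srt ne
  last : ∀ {x} → x ≢ y → All (λ z → lastPos x (p ++ y ∷ []) < lastPos z (p ++ y ∷ [])) (y ∷ [])
  last {x} x≢y = subst₂ _<_ (sym (lastPos-other p x≢y)) (sym (lastPos-self y p)) (s≤s (lastPosAux-bound x 0 p 0 z≤n)) ∷ []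

drop-length-++ : ∀ (q r : List ℕ) → drop (length q) (q ++ r) ≡ r
drop-length-++ []      r = refl
drop-length-++ (x ∷ q) r = drop-length-++ q r

suffix-++ : ∀ q {r m} → length r ≡ m → suffix m (q ++ r) ≡ r
suffix-++ q {r} refl rewrite length-++ q {r} | m+n∸n≡m (length q) (length r) = drop-length-++ q r

elemB-∈ : ∀ {a} {r} → a ∈ r → elemB a r ≡ true
elemB-∈ {a} (here refl) rewrite ≡ᵇ-refl a = refl
elemB-∈ {a} {x ∷ r} (there a∈r) with a ≡ᵇ x
... | true  = refl
... | false = elemB-∈ a∈r

elemB-∉ : ∀ {a r} → All (a ≢_) r → elemB a r ≡ false
elemB-∉ []        = refl
elemB-∉ (ne ∷ nes) rewrite ≢⇒≡ᵇ ne = elemB-∉ nes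

↭-pair : ∀ {xs : List ℕ} {a b} → xs ↭ a ∷ b ∷ [] → xs ≡ a ∷ b ∷ [] ⊎ xs ≡ b ∷ a ∷ []
↭-pair {xs} {a} {b} p with xs | ↭-length p | p
... | c ∷ d ∷ [] | refl | p with ∈-resp-↭ p (here refl)
... | here refl         with ↭-singleton-inv (drop-∷ p)
... | refl = inj₁ refl
↭-pair {xs} {a} {b} _ | c ∷ d ∷ [] | refl | p | there (here refl)
  with ↭-singleton-inv (drop-∷ (↭-trans p (∷↭∷ʳ a (b ∷ []))))
... | refl = inj₂ refl

module _ (k : ℕ) (q r : List ℕ) {a b : ℕ} (len : length r ≡ k ∸ 2) where
  private
    p = q ++ r

    Missing? : ∀ x → _
    Missing? x = T? (not (elemB x (suffix (k ∸ 2) p)))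

  -- By distinctness the filter keeps exactly `a` and `b`. Their order in the alphabet is unknown,
  -- hence the two cases of `↭-pair`; comparing last positions then puts `a` first in both.
  rank-recency : ByRecency p (a ∷ b ∷ r) → (a ∷ b ∷ r) ↭ alphabet k → rank k p ≡ a ∷ b ∷ r
  rank-recency sorted@((a<b ∷ _) ∷ _) perm = trans (two (↭-pair (subst (λ xs → filter Missing? (alphabet k) ↭ xs) kept (filter-↭ Missing? (↭-sym perm)))))
                                   (cong (λ x → a ∷ b ∷ x) (suffix-++ q len))
    where
    distinct = recency-distinct {p} sorted
    missing : ∀ {x} → All (x ≢_) r → Bool.T (not (elemB x (suffix (k ∸ 2) p)))
    missing {x} ne = subst (λ s → Bool.T (not (elemB x s))) (sym (suffix-++ q len))
                       (subst (Bool.T ∘ not) (sym (elemB-∉ ne)) tt)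
    present : ∀ {x} → x ∈ r → ¬ Bool.T (not (elemB x (suffix (k ∸ 2) p)))
    present {x} x∈r t = subst (Bool.T ∘ not) (elemB-∈ x∈r) (subst (λ s → Bool.T (not (elemB x s))) (suffix-++ q len) t)
    kept : filter Missing? (a ∷ b ∷ r) ≡ a ∷ b ∷ []
    kept with distinct
    ... | (_ ∷ a≢) ∷ b≢ ∷ _ =
      trans (filter-accept Missing? (missing a≢)) (cong (a ∷_) (trans (filter-accept Missing? (missing b≢))
        (cong (b ∷_) (filter-none Missing? (All.tabulate present)))))
    two : filter Missing? (alphabet k) ≡ a ∷ b ∷ [] ⊎ filter Missing? (alphabet k) ≡ b ∷ a ∷ [] →
          rank k p ≡ a ∷ b ∷ suffix (k ∸ 2) p
    two (inj₁ eq) rewrite eq with lastPos b p ≤ᵇ lastPos a p in le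
    ... | true  = ⊥-elim (<⇒≱ a<b (≤ᵇ⇒≤ _ _ (subst Bool.T (sym le) tt)))
    ... | false = refl
    two (inj₂ eq) rewrite eq with lastPos a p ≤ᵇ lastPos b p in le
    ... | true  = refl
    ... | false = ⊥-elim (subst Bool.T le (≤⇒≤ᵇ (<⇒≤ a<b)))

-- The interface through which the avoidance proof sees `w`. Here k is `3 + K`; with k = `4 + K` in
-- the certificates it is used at `suc K`.
record Decoded (K : ℕ) (T w : ℕ → ℕ) : Set where
  field
    S          : ℕ → List ℕ
    S-zero     : S 0 ≡ 3 + K ∷ map suc (upTo (2 + K))
    S-suc      : ∀ n → S (suc n) ≡ mv (T n) (S n)
    S-length   : ∀ n → length (S n) ≡ 3 + K
    S-perm     : ∀ n → S n ↭ alphabet (3 + K)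
    S-distinct : ∀ n → AllPairs _≢_ (S n)
    w-start    : Occ w 0 (drop 1 (S 0))
    w-suffix   : ∀ n → Occ w (suc n) (drop 2 (S n))
    w-out      : ∀ n → w (n + (2 + K)) ≡ nth (S n) (T n ∸ 1)

module Decoding (K : ℕ) (T : ℕ → ℕ) (T-code : ∀ n → Code (T n))
  (start-sorted : ByRecency (map suc (upTo (2 + K))) (3 + K ∷ map suc (upTo (2 + K))))
  (start-perm : 3 + K ∷ map suc (upTo (2 + K)) ↭ alphabet (3 + K)) where

  private
    k : ℕ
    k = 3 + K

  w : ℕ → ℕ
  w = decode k T

  S : ℕ → List ℕ
  S zero    = k ∷ map suc (upTo (2 + K))
  S (suc n) = mv (T n) (S n)

  record State (n : ℕ) : Set where
    constructor state
    field
      {a b} : ℕ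
      {v q} : List ℕ
      shape   : S n ≡ a ∷ b ∷ v
      prefix  : prefixP k T n ≡ q ++ v
      -- The prefix has length `n + (2 + K)` and `v` has length `1 + K`, so `v` starts at position
      -- `suc n` of `w`.
      q-len   : length q ≡ suc n
      sorted  : ByRecency (prefixP k T n) (a ∷ b ∷ v)
      perm    : a ∷ b ∷ v ↭ alphabet k

    v-len : length v ≡ suc K
    v-len = suc-injective (suc-injective
              (trans (↭-length perm) (trans (length-map suc (upTo k)) (length-upTo k))))

    ranked : rank k (prefixP k T n) ≡ a ∷ b ∷ v
    ranked = trans (cong (rank k) prefix)
      (rank-recency k q v v-len (subst (λ p → ByRecency p (a ∷ b ∷ v)) prefix sorted) perm)

    distinct : AllPairs _≢_ (a ∷ b ∷ v)
    distinct = recency-distinct {prefixP k T n} sorted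

  out : ℕ → ℕ
  out n = nth (S n) (T n ∸ 1)

  prefix-snoc′ : ∀ {n} → State n → prefixP k T (suc n) ≡ prefixP k T n ++ out n ∷ []
  prefix-snoc′ {n} st = cong (λ s → prefixP k T n ++ nth s (T n ∸ 1) ∷ []) (trans ranked (sym shape))
    where open State st

  state-at : ∀ n → State n
  state-at zero    = state {q = 1 ∷ []} refl refl refl start-sorted start-perm
  state-at (suc n) with state-at n
  ... | st@(state {a} {b} {[]} _ _ _ _ _) with State.v-len st
  ... | ()
  state-at (suc n) | st@(state {a} {b} {c ∷ r} {q} shape prefix q-len sorted perm) =
    step (T-code n) (State.distinct st) sorted
    where
    P = prefixP k T n

    next : ∀ {z d y} → S (suc n) ≡ z ∷ d ∷ r ++ y ∷ [] → out n ≡ y →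
           ByRecency P (z ∷ d ∷ r) → All (_≢ y) (z ∷ d ∷ r) →
           z ∷ d ∷ r ++ y ∷ [] ↭ a ∷ b ∷ c ∷ r → State (suc n)
    next {z} {d} {y} shp refl srt ne prm = state {q = q ++ c ∷ []} shp
      (trans P′≡ (trans (cong (_++ y ∷ []) prefix) (trans (++-assoc q (c ∷ r) (y ∷ [])) (sym (++-assoc q (c ∷ []) (r ++ y ∷ []))))))
      (trans (length-++ q) (trans (+-comm (length q) 1) (cong suc q-len)))
      (subst (λ p → ByRecency p (z ∷ d ∷ r ++ y ∷ [])) (sym P′≡) (recency-snoc {P} srt ne))
      (↭-trans prm perm)
      where
      P′≡ : prefixP k T (suc n) ≡ P ++ y ∷ []
      P′≡ = prefix-snoc′ st

    mv≡ : ∀ {t s} → T n ≡ t → mv t (a ∷ b ∷ c ∷ r) ≡ s → S (suc n) ≡ s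
    mv≡ t≡ eq = trans (cong₂ mv t≡ shape) eq

    out≡ : ∀ {t y} → T n ≡ t → nth (a ∷ b ∷ c ∷ r) (t ∸ 1) ≡ y → out n ≡ y
    out≡ t≡ eq = trans (cong₂ (λ t s → nth s (t ∸ 1)) t≡ shape) eq

    step : Code (T n) → AllPairs _≢_ (a ∷ b ∷ c ∷ r) → ByRecency P (a ∷ b ∷ c ∷ r) → State (suc n)
    step (inj₁ t)        (a≢ ∷ _) (_ ∷ srt) =
      next (mv≡ t refl) (out≡ t refl) srt (All.map (_∘ sym) a≢) (↭-sym (∷↭∷ʳ a (b ∷ c ∷ r)))
    step (inj₂ (inj₁ t)) ((a≢b ∷ _) ∷ b≢ ∷ _) ((_ ∷ a<) ∷ _ ∷ srt) =
      next (mv≡ t refl) (out≡ t refl) (a< ∷ srt) (a≢b ∷ All.map (_∘ sym) b≢) (prep a (↭-sym (∷↭∷ʳ b (c ∷ r))))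
    step (inj₂ (inj₂ t)) ((_ ∷ a≢c ∷ _) ∷ (b≢c ∷ _) ∷ c≢ ∷ _) ((a<b ∷ _ ∷ a<) ∷ (_ ∷ b<) ∷ _ ∷ srt) =
      next (mv≡ t refl) (out≡ t refl) ((a<b ∷ a<) ∷ b< ∷ srt) (a≢c ∷ b≢c ∷ All.map (_∘ sym) c≢)
           (prep a (prep b (↭-sym (∷↭∷ʳ c r))))

  prefix-snoc : ∀ n → prefixP k T (suc n) ≡ prefixP k T n ++ out n ∷ []
  prefix-snoc n = prefix-snoc′ (state-at n)

  prefix-len : ∀ n → length (prefixP k T n) ≡ n + (2 + K)
  prefix-len zero    = trans (length-map suc (upTo (2 + K))) (length-upTo (2 + K))
  prefix-len (suc n) = trans (length-++ (prefixP k T n)) (trans (+-comm (length (prefixP k T n)) 1) (cong suc (prefix-len n)))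

  open Limit (prefixP k T) (λ n → _ , refl) (λ n → subst (n <_) (sym (prefix-len n)) (m<m+n n (s≤s z≤n)))
    using () renaming (limit-prefix to w-prefix)

  w-suffix : ∀ n → Occ w (suc n) (drop 2 (S n))
  w-suffix n = subst (Occ w (suc n)) (sym (cong (drop 2) shape))
    (subst (λ m → Occ w m v) q-len (occ-++ʳ q (subst (Occ w 0) prefix (w-prefix n))))
    where open State (state-at n)

  w-out : ∀ n → w (n + (2 + K)) ≡ out n
  w-out n = proj₁ (subst (λ m → Occ w m (out n ∷ [])) (prefix-len n)
    (occ-++ʳ (prefixP k T n) (subst (Occ w 0) (prefix-snoc n) (w-prefix (suc n)))))

  S-length : ∀ n → length (S n) ≡ k
  S-length n = trans (cong length shape) (cong (2 +_) v-len)
    where open State (state-at n)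

  S-perm : ∀ n → S n ↭ alphabet k
  S-perm n = subst (_↭ alphabet k) (sym shape) perm
    where open State (state-at n)

  S-distinct : ∀ n → AllPairs _≢_ (S n)
  S-distinct n = subst (AllPairs _≢_) (sym shape) distinct
    where open State (state-at n)

  decoded : Decoded K T w
  decoded = record
    { S = S ; S-zero = refl ; S-suc = λ _ → refl ; S-length = S-length ; S-perm = S-perm ; S-distinct = S-distinct
    ; w-start = w-prefix 0 ; w-suffix = w-suffix ; w-out = w-out }

-- What the 3s and the letters of w say about rankings

module Ranks {K : ℕ} {T w : ℕ → ℕ} (T-code : ∀ n → Code (T n)) (no-33 : ∀ {n} → T (suc n) ≡ 3 → T n ≢ 3)
             (dec : Decoded K T w) where
  open Decoded dec public

  T≡3⇒w : ∀ n → T n ≡ 3 → w (suc n) ≡ w (n + (2 + K))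
  T≡3⇒w n t with S n | S-length n | w-suffix n | w-out n
  ... | a ∷ b ∷ c ∷ r | _ | eq , _ | eq′ rewrite t = trans eq (sym eq′)

  -- Codes 1 and 2 output one of the two letters outside the suffix, and these differ from its first
  -- letter `c`.
  w⇒T≡3 : ∀ n → w (suc n) ≡ w (n + (2 + K)) → T n ≡ 3
  w⇒T≡3 n eq with T n | T-code n | S n | S-length n | w-suffix n | w-out n | S-distinct n
  ... | _ | inj₁ refl        | a ∷ b ∷ c ∷ r | _ | c≡ , _ | out≡ | (_ ∷ a≢c ∷ _) ∷ _ =
    ⊥-elim (a≢c (trans (sym out≡) (trans (sym eq) c≡)))
  ... | _ | inj₂ (inj₁ refl) | a ∷ b ∷ c ∷ r | _ | c≡ , _ | out≡ | _ ∷ (b≢c ∷ _) ∷ _ =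
    ⊥-elim (b≢c (trans (sym out≡) (trans (sym eq) c≡)))
  ... | _ | inj₂ (inj₂ refl) | _ | _ | _ | _ | _ = refl

  -- Before a 3 comes no 3, so the second-ranked letter is the one just before the suffix.
  occ-tail : ∀ n → T n ≡ 3 → Occ w n (drop 1 (S n))
  occ-tail zero    _ = w-start
  occ-tail (suc n) t with T n | T-code n | no-33 t | S n | S-length n | w-suffix n | S (suc n) | S-suc n | w-suffix (suc n)
  ... | _ | inj₁ refl        | _   | a ∷ b ∷ c ∷ r | _ | c≡ , _ | _ | refl | occ = c≡ , occ
  ... | _ | inj₂ (inj₁ refl) | _   | a ∷ b ∷ c ∷ r | _ | c≡ , _ | _ | refl | occ = c≡ , occ
  ... | _ | inj₂ (inj₂ refl) | 3≢3 | _             | _ | _      | _ | _    | _   = ⊥-elim (3≢3 refl)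

  -- At a 3, the ranking without its first letter is a window of k-1 letters of `w`, so equal
  -- windows give equal tails. Both rankings are permutations of one alphabet, so their sums agree,
  -- and this forces the first letters to be equal too.
  S-≡ : ∀ m n → T m ≡ 3 → T n ≡ 3 → (∀ {j} → j < 2 + K → w (m + j) ≡ w (n + j)) → S m ≡ S n
  S-≡ m n tm tn eq with S m | S-length m | occ-tail m tm | sum-↭ (S-perm m) | S n | S-length n | occ-tail n tn | sum-↭ (S-perm n)
  ... | x ∷ s | |s| | occ | Σ | x′ ∷ s′ | |s′| | occ′ | Σ′ = cong₂ _∷_ (+-cancelʳ-≡ (sum s) x x′ heads) tails
    where
    same : ∀ {i j} u v → length u ≡ length v → Occ w i u → Occ w j v →
           (∀ {l} → l < length u → w (i + l) ≡ w (j + l)) → u ≡ v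
    same []      []      _   _          _          _  = refl
    same {i} {j} (x ∷ u) (y ∷ v) len (refl , o) (refl , o′) eq = cong₂ _∷_
      (trans (cong w (sym (+-identityʳ i))) (trans (eq (s≤s z≤n)) (cong w (+-identityʳ j))))
      (same u v (suc-injective len) o o′ (λ {l} l< → trans (cong w (sym (+-suc i l))) (trans (eq (s≤s l<)) (cong w (+-suc j l)))))
    tails : s ≡ s′
    tails = same s s′ (suc-injective (trans |s| (sym |s′|))) occ occ′ (λ l< → eq (subst (_ <_) (suc-injective |s|) l<))
    heads : x + sum s ≡ x′ + sum s
    heads = trans Σ (trans (sym Σ′) (cong (λ z → x′ + sum z) (sym tails)))

-- Boolean checkers for finite words and their soundness

if-true : ∀ b {c} → (if b then c else false) ≡ true → b ≡ true × c ≡ true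
if-true true eq = refl , eq

if-false : ∀ b {c} → (if b then false else c) ≡ true → b ≡ false × c ≡ true
if-false false eq = refl , eq

nth-applyUpTo : ∀ (φ : ℕ → ℕ) {n i} → i < n → nth (applyUpTo φ n) i ≡ φ i
nth-applyUpTo φ {suc n} {zero}  _         = refl
nth-applyUpTo φ {suc n} {suc i} (s≤s i<n) = nth-applyUpTo (φ ∘ suc) i<n

nth-map-upTo : ∀ (φ : ℕ → ℕ) {n i} → i < n → nth (map φ (upTo n)) i ≡ φ i
nth-map-upTo φ {n} {i} i<n = trans (cong (λ l → nth l i) (map-upTo φ n)) (nth-applyUpTo φ i<n)

length-map-upTo : ∀ (φ : ℕ → ℕ) n → length (map φ (upTo n)) ≡ n
length-map-upTo φ n = trans (length-map φ (upTo n)) (length-upTo n)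

agree : ℕ → List ℕ → List ℕ → Bool
agree zero    xs       ys       = true
agree (suc n) (x ∷ xs) (y ∷ ys) = if x ≡ᵇ y then agree n xs ys else false
agree (suc n) _        _        = false

agree-complete : ∀ c xs ys → c ≤ length xs → c ≤ length ys →
                 (∀ {t} → t < c → nth xs t ≡ nth ys t) → agree c xs ys ≡ true
agree-complete zero    xs       ys       _         _         _  = refl
agree-complete (suc c) (x ∷ xs) (y ∷ ys) (s≤s c≤x) (s≤s c≤y) eq
  rewrite eq {0} (s≤s z≤n) | ≡ᵇ-refl y = agree-complete c xs ys c≤x c≤y (λ t<c → eq (s≤s t<c))

-- apart (c₀ ∷ c₁ ∷ …) xs ys: for no d does a prefix of xs of length 1 + c_d occur in ys at position d.
apart : List ℕ → List ℕ → List ℕ → Bool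
apart []       xs ys       = true
apart (c ∷ cs) xs []       = true
apart (c ∷ cs) xs (y ∷ ys) = if agree (suc c) xs (y ∷ ys) then false else apart cs xs ys

-- Entry `d` of `cs` belongs to the period `suc d` and is one less than the length forbidden for it;
-- the first `n` starting positions are tried.
noRepeat : ℕ → List ℕ → List ℕ → Bool
noRepeat zero    cs xs       = true
noRepeat (suc n) cs []       = true
noRepeat (suc n) cs (x ∷ xs) = if apart cs (x ∷ xs) xs then noRepeat n cs xs else false

-- `l` holds the letters already passed, the latest first, so a mirrored pair becomes a plain
-- agreement of `x ∷ l` with a later part of the word.
noMirror : ℕ → List ℕ → List ℕ → List ℕ → Bool
noMirror zero    cs l xs       = true
noMirror (suc n) cs l []       = true
noMirror (suc n) cs l (x ∷ xs) = if apart cs (x ∷ l) xs then noMirror n cs (x ∷ l) xs else false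

apart-sound : ∀ cs xs ys → apart cs xs ys ≡ true → ∀ {d c} → d < length cs → nth cs d ≡ c →
              c < length xs → d + c < length ys → ¬ (∀ {t} → t ≤ c → nth xs t ≡ nth ys (d + t))
apart-sound (c ∷ cs) xs (y ∷ ys) ok {zero}  _ refl c<x c<y eq
  with () ← trans (sym (proj₁ (if-false _ ok))) (agree-complete (suc c) xs (y ∷ ys) c<x c<y (λ { (s≤s t≤c) → eq t≤c }))
apart-sound (c ∷ cs) xs (y ∷ ys) ok {suc d} (s≤s d<) eqc c<x (s≤s dc<y) eq =
  apart-sound cs xs ys (proj₂ (if-false (agree (suc c) xs (y ∷ ys)) ok)) d< eqc c<x dc<y eq

noRepeat-sound : ∀ n cs xs → noRepeat n cs xs ≡ true → ∀ {j d c} → j < n → d < length cs → nth cs d ≡ c →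
                 j + suc d + c < length xs → ¬ (∀ {t} → t ≤ c → nth xs (j + t) ≡ nth xs (j + suc d + t))
noRepeat-sound (suc n) cs (x ∷ xs) ok {zero} {d} {c} _ d< eqc dc< eq =
  apart-sound cs (x ∷ xs) xs (proj₁ (if-true _ ok)) d< eqc (≤-trans (s≤s (m≤n+m c (suc d))) dc<) (≤-pred dc<) eq
noRepeat-sound (suc n) cs (x ∷ xs) ok {suc j} (s≤s j<n) d< eqc (s≤s dc<) eq =
  noRepeat-sound n cs xs (proj₂ (if-true (apart cs (x ∷ xs) xs) ok)) j<n d< eqc dc< eq
noRepeat-sound (suc n) cs [] ok _ _ _ () _

-- The list `x ∷ l` that `noMirror` compares when it has reached position `j`.
push : ℕ → List ℕ → List ℕ → List ℕ
push j       l []       = l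
push zero    l (x ∷ xs) = x ∷ l
push (suc j) l (x ∷ xs) = push j (x ∷ l) xs

nth-push-skip : ∀ j l xs t → j < length xs → nth (push j l xs) (suc j + t) ≡ nth l t
nth-push-skip zero    l (x ∷ xs) t _        = refl
nth-push-skip (suc j) l (x ∷ xs) t (s≤s j<) =
  trans (cong (nth (push j (x ∷ l) xs)) (sym (cong suc (+-suc j t)))) (nth-push-skip j (x ∷ l) xs (suc t) j<)

nth-push : ∀ j l xs {t s} → j < length xs → t + s ≡ j → nth (push j l xs) t ≡ nth xs s
nth-push zero    l (x ∷ xs) {zero} {zero} _ refl = refl
nth-push (suc j) l (x ∷ xs) {t} {zero} (s≤s j<) eq =
  trans (cong (nth (push j (x ∷ l) xs)) (+-cancelʳ-≡ 0 t (suc j + 0) (trans eq (cong suc (sym (trans (+-identityʳ _) (+-identityʳ j)))))))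
    (nth-push-skip j (x ∷ l) xs 0 j<)
nth-push (suc j) l (x ∷ xs) {t} {suc s} (s≤s j<) eq =
  nth-push j (x ∷ l) xs j< (suc-injective (trans (sym (+-suc t s)) eq))

noMirror-sound : ∀ n cs l xs → noMirror n cs l xs ≡ true → ∀ {j d c} → j < n → d < length cs → nth cs d ≡ c →
                 c ≤ j + length l → j + suc d + c < length xs →
                 ¬ (∀ {t} → t ≤ c → nth (push j l xs) t ≡ nth xs (j + suc d + t))
noMirror-sound (suc n) cs l (x ∷ xs) ok {zero} {d} {c} _ d< eqc c≤ dc< eq =
  apart-sound cs (x ∷ l) xs (proj₁ (if-true _ ok)) d< eqc (s≤s c≤) (≤-pred dc<) eq
noMirror-sound (suc n) cs l (x ∷ xs) ok {suc j} {c = c} (s≤s j<n) d< eqc c≤ (s≤s dc<) eq =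
  noMirror-sound n cs (x ∷ l) xs (proj₂ (if-true (apart cs (x ∷ l) xs) ok)) j<n d< eqc
    (subst (c ≤_) (sym (+-suc j (length l))) c≤) dc< eq
noMirror-sound (suc n) cs l [] ok _ _ _ _ () _

module _ {v : ℕ → ℕ} {i : ℕ} (xs : List ℕ) (occ : Occ v i xs) (φ : ℕ → ℕ) (N : ℕ) where

  private
    at : ∀ {j} → j < length xs → v (i + j) ≡ nth xs j
    at = occ-nth xs occ

  occ-noRepeat : ∀ n → noRepeat n (map φ (upTo N)) xs ≡ true → ∀ {j d} → j < n → d < N →
                 j + suc d + φ d < length xs → ¬ (∀ {t} → t ≤ φ d → v (i + j + t) ≡ v (i + j + suc d + t))
  occ-noRepeat n ok {j} {d} j<n d<N len eq =
    noRepeat-sound n _ xs ok j<n (subst (d <_) (sym (length-map-upTo φ N)) d<N) (nth-map-upTo φ d<N) len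
      λ {t} t≤ → let
        lt = ≤-trans (s≤s (+-monoʳ-≤ (j + suc d) t≤)) len in
        trans (sym (at (≤-trans (s≤s (+-monoˡ-≤ t (m≤m+n j (suc d)))) lt)))
          (trans (cong v (sym (+-assoc i j t))) (trans (eq t≤)
            (trans (cong v (trans (cong (_+ t) (+-assoc i j (suc d))) (+-assoc i (j + suc d) t))) (at lt))))

  occ-noMirror : ∀ n → noMirror n (map φ (upTo N)) [] xs ≡ true → ∀ {j d} → j < n → d < N →
                 φ d ≤ j → j + suc d + φ d < length xs →
                 ¬ (∀ {t s} → t ≤ φ d → t + s ≡ j → v (i + s) ≡ v (i + j + suc d + t))
  occ-noMirror n ok {j} {d} j<n d<N c≤j len eq =
    noMirror-sound n _ [] xs ok j<n (subst (d <_) (sym (length-map-upTo φ N)) d<N) (nth-map-upTo φ d<N)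
      (subst (φ d ≤_) (sym (+-identityʳ j)) c≤j) len
      λ {t} t≤ → let
        lt = ≤-trans (s≤s (+-monoʳ-≤ (j + suc d) t≤)) len
        j< = ≤-trans (s≤s (≤-trans (m≤m+n j (suc d)) (m≤m+n (j + suc d) (φ d)))) len
        t≤j = ≤-trans t≤ c≤j in
        trans (nth-push j [] xs j< (m+[n∸m]≡n t≤j))
          (trans (sym (at (≤-trans (s≤s (m∸n≤m j t)) j<))) (trans (eq t≤ (m+[n∸m]≡n t≤j))
            (trans (cong v (trans (cong (_+ t) (+-assoc i j (suc d))) (+-assoc i (j + suc d) t))) (at lt))))

all-sound : ∀ {A : Set} (p : A → Bool) xs → all p xs ≡ true → ∀ {x} → x ∈ xs → p x ≡ true
all-sound p (x ∷ xs) ok (here refl) with p x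
... | true = refl
all-sound p (x ∷ xs) ok (there x∈) with p x
... | true = all-sound p xs ok x∈

-- Renames each letter to its place in a ranking. This turns every ranking into `upTo k`, so
-- computations started from that single list cover all positions of `w`.
index : List ℕ → ℕ → ℕ
index []       x = 0
index (y ∷ ys) x = if x ≡ᵇ y then 0 else suc (index ys x)

map-index : ∀ {s} → AllPairs _≢_ s → map (index s) s ≡ upTo (length s)
map-index []                    = refl
map-index {y ∷ ys} (y≢ ∷ dist) = cong₂ _∷_ (cong (λ b → if b then 0 else suc (index ys y)) (≡ᵇ-refl y)) (begin
  map (index (y ∷ ys)) ys        ≡⟨ map-cong-local (All.map (λ {x} y≢x → cong (λ b → if b then 0 else suc (index ys x)) (≢⇒≡ᵇ (y≢x ∘ sym))) y≢) ⟩
  map (suc ∘ index ys) ys        ≡⟨ map-∘ ys ⟩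
  map suc (map (index ys) ys)    ≡⟨ cong (map suc) (map-index dist) ⟩
  map suc (upTo (length ys))     ≡⟨ map-upTo suc (length ys) ⟩
  applyUpTo suc (length ys)      ∎)
  where open ≡-Reasoning

nth-reverse : ∀ xs {t s} → suc (t + s) ≡ length xs → nth (reverse xs) t ≡ nth xs s
nth-reverse (x ∷ xs) {t} {zero}  eq = trans (cong (λ l → nth l t) (unfold-reverse x xs))
  (last (reverse xs) (trans (sym (+-identityʳ t)) (trans (suc-injective eq) (sym (length-reverse xs)))))
  where
  last : ∀ ys {t} → t ≡ length ys → nth (ys ++ x ∷ []) t ≡ x
  last []       refl = refl
  last (y ∷ ys) refl = last ys refl
nth-reverse (x ∷ xs) {t} {suc s} eq = trans (cong (λ l → nth l t) (unfold-reverse x xs))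
  (trans (nth-++ˡ (reverse xs) (x ∷ []) (subst (t <_) (sym (length-reverse xs)) (subst (t <_) eq′ (s≤s (m≤m+n t s)))))
    (nth-reverse xs eq′))
  where
  eq′ : suc (t + s) ≡ length xs
  eq′ = trans (sym (+-suc t s)) (suc-injective eq)

-- Action of code words on rankings

mvs : List ℕ → List ℕ → List ℕ
mvs []      s = s
mvs (t ∷ u) s = mvs u (mv t s)

outs : List ℕ → List ℕ → List ℕ
outs []      s = []
outs (t ∷ u) s = nth s (t ∸ 1) ∷ outs u (mv t s)

-- Makes comparing rankings cheap; its injectivity is irrelevant, since equal
-- rankings only have to be detected.
code : List ℕ → ℕ
code = foldr (λ x c → x + 16 * c) 0

codes : List ℕ → List ℕ → List ℕ
codes []      s = code s ∷ []
codes (x ∷ u) s = code s ∷ codes u (mvs (g x) s)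

-- `mv` moves places without inspecting letters. Leaving unsuitable codes and short lists unchanged
-- lets this hold without side conditions.
mv-map : ∀ h t s → mv t (map h s) ≡ map h (mv t s)
mv-map h 0 s                         = refl
mv-map h 1 []                        = refl
mv-map h 1 (a ∷ s)                   = sym (map-++ h s (a ∷ []))
mv-map h 2 []                        = refl
mv-map h 2 (a ∷ [])                  = refl
mv-map h 2 (a ∷ b ∷ s)               = cong (h a ∷_) (sym (map-++ h s (b ∷ [])))
mv-map h 3 []                        = refl
mv-map h 3 (a ∷ [])                  = refl
mv-map h 3 (a ∷ b ∷ [])              = refl
mv-map h 3 (a ∷ b ∷ c ∷ s)           = cong (λ z → h a ∷ h b ∷ z) (sym (map-++ h s (c ∷ [])))
mv-map h (suc (suc (suc (suc t)))) s = refl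

mvs-map : ∀ h u s → mvs u (map h s) ≡ map h (mvs u s)
mvs-map h []      s = refl
mvs-map h (t ∷ u) s = trans (cong (mvs u) (mv-map h t s)) (mvs-map h u (mv t s))

nth-map : ∀ (h : ℕ → ℕ) s {i} → i < length s → nth (map h s) i ≡ h (nth s i)
nth-map h (x ∷ s) {zero}  _         = refl
nth-map h (x ∷ s) {suc i} (s≤s i<s) = nth-map h s i<s

-- Lets an equality of rankings be carried backwards through equal codes, down to a block boundary.
mv-injective : ∀ {t} → Code t → ∀ s s′ → 3 ≤ length s → 3 ≤ length s′ → mv t s ≡ mv t s′ → s ≡ s′
mv-injective t (_ ∷ []) _ (s≤s ()) _ _
mv-injective t (_ ∷ _ ∷ []) _ (s≤s (s≤s ())) _ _
mv-injective t (_ ∷ _ ∷ _ ∷ _) (_ ∷ []) _ (s≤s ()) _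
mv-injective t (_ ∷ _ ∷ _ ∷ _) (_ ∷ _ ∷ []) _ (s≤s (s≤s ())) _
mv-injective (inj₁ refl) (a ∷ b ∷ c ∷ s) (a′ ∷ b′ ∷ c′ ∷ s′) _ _ eq
  with ∷ʳ-injective (b ∷ c ∷ s) (b′ ∷ c′ ∷ s′) eq
... | refl , refl = refl
mv-injective (inj₂ (inj₁ refl)) (a ∷ b ∷ c ∷ s) (a′ ∷ b′ ∷ c′ ∷ s′) _ _ eq
  with ∷ʳ-injective (a ∷ c ∷ s) (a′ ∷ c′ ∷ s′) eq
... | refl , refl = refl
mv-injective (inj₂ (inj₂ refl)) (a ∷ b ∷ c ∷ s) (a′ ∷ b′ ∷ c′ ∷ s′) _ _ eq
  with ∷ʳ-injective (a ∷ b ∷ s) (a′ ∷ b′ ∷ s′) eq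
... | refl , refl = refl

-- Finite data and the certificate

pairs : List (List ℕ)
pairs = (1 ∷ 1 ∷ []) ∷ (1 ∷ 2 ∷ []) ∷ (2 ∷ 1 ∷ []) ∷ (2 ∷ 2 ∷ []) ∷ []

∈-pairs : ∀ {x y} → Binary x → Binary y → x ∷ y ∷ [] ∈ pairs
∈-pairs (inj₁ refl) (inj₁ refl) = here refl
∈-pairs (inj₁ refl) (inj₂ refl) = there (here refl)
∈-pairs (inj₂ refl) (inj₁ refl) = there (there (here refl))
∈-pairs (inj₂ refl) (inj₂ refl) = there (there (there (here refl)))

windows : ℕ → ℕ → List ℕ → List (List ℕ)
windows c n u = map (λ o → take c (drop o u)) (upTo n)

∈-windows : ∀ c {n o} u → o < n → take c (drop o u) ∈ windows c n u
∈-windows c u o<n = ∈-map⁺ (λ o → take c (drop o u)) (∈-upTo⁺ o<n)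

mark : ℕ → ℕ
mark t = if t ≡ᵇ 3 then 1 else 0

marks : List ℕ → List ℕ
marks = map mark

≤ᵇ-true : ∀ {m n} → (m ≤ᵇ n) ≡ true → m ≤ n
≤ᵇ-true {m} {n} eq = ≤ᵇ⇒≤ m n (subst Bool.T (sym eq) tt)

-- The mirrored words are an argument of their own so that they are computed only once.
mirrorFree : ℕ → List (List ℕ) → List (List ℕ) → Bool
mirrorFree N us vs = all (λ u → all (λ v → not (agree N u v)) vs) us

phased : ℕ → List (ℕ × List ℕ) → Bool
phased N us = all (λ (o , u) → all (λ (o′ , u′) → (o ≡ᵇ o′) ∨ not (agree N u u′)) us) us

module Finite (f : ℕ → List ℕ) (L : ℕ) where

  private
    f* : List ℕ → List ℕ
    f* = applyMorph f

  -- A code window of length `N` can reach beyond two blocks, so a third letter is supplied. Only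
  -- triples found in images of pairs are listed, to keep spurious factors out of the mirror check.
  triples : List (List ℕ)
  triples = deduplicate (≡-dec _≟_) (concatMap (windows 3 L ∘ f*) pairs)

  phasesOf : List ℕ → List (ℕ × List ℕ)
  phasesOf u = map (λ o → o , take L (drop o (f* u))) (upTo L)

  phases : List (ℕ × List ℕ)
  phases = concatMap phasesOf pairs

  block : ℕ → List ℕ → ℕ
  block j u = length (g* (iter j f* (take 1 u)))

  codeWindowsOf : ℕ → ℕ → List ℕ → List (List ℕ)
  codeWindowsOf N j u = windows N (block j u) (g* (iter j f* u))

  codeWindows : ℕ → ℕ → List (List ℕ)
  codeWindows N j = concatMap (codeWindowsOf N j) triples

  -- The code word starts with 3, so the ranking 0 1 ⋯ k-1 comes from the suffix 1 ⋯ k-1 read so far.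
  model : ℕ → ℕ → List ℕ → List ℕ
  model k j u = drop 1 (upTo k) ++ outs (g* (iter j f* u)) (upTo k)

  kernelModel : ℕ → ℕ → List ℕ → List ℕ
  kernelModel k j u = codes (iter j f* u) (upTo k)

record Certificate (K L : ℕ) : Set where
  k : ℕ
  k = 4 + K

  f : ℕ → List ℕ
  f = fOf k

  open Finite f L public

  field
    uniform     : Uniform f L
    -- A repetition may cover only the end of its first block; the last letter still identifies that
    -- block.
    last-differ : nth (f 1) (L ∸ 1) ≢ nth (f 2) (L ∸ 1)
    phase-len   : all (λ (_ , u) → L ≤ᵇ length u) phases ≡ true
    phase-ok    : phased L phases ≡ true

    N jN        : ℕ
    mirror-len  : all (λ u → N ≤ᵇ length u) (codeWindows N jN) ≡ true
    mirror-ok   : mirrorFree N (map marks (codeWindows N jN)) (map (reverse ∘ marks) (codeWindows N jN)) ≡ true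

    start-sorted : ByRecency (map suc (upTo (3 + K))) (k ∷ map suc (upTo (3 + K)))
    start-perm   : k ∷ map suc (upTo (3 + K)) ↭ alphabet k

    -- Sends the ranking at 3 number n to the one at 3 number `L * n`; `E-start` and `E-act` are the
    -- base and the step of that induction.
    E           : List ℕ → List ℕ
    E-injective : ∀ {s s′} → s ↭ alphabet k → s′ ↭ alphabet k → E s ≡ E s′ → s ≡ s′
    E-start     : E (k ∷ map suc (upTo (3 + K))) ≡ k ∷ map suc (upTo (3 + K))
    E-act       : ∀ {x} → Binary x → ∀ s → length s ≡ k → mvs (g* (f x)) (E s) ≡ E (mvs (g x) s)

    -- Certifies A₁ (ℓ + 1) ≤ A₂ q for kernel repetitions of length ℓ < L and period q;
    -- this inequality survives desubstitution.
    A₁ A₂ jA    : ℕ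
    .{{A₁≢0}}   : NonZero A₁
    .{{A₂≢0}}   : NonZero A₂
    kernel-len  : All (λ u → (L ^ jA + (A₁ * L + L) ≤ᵇ length (kernelModel k jA u)) ≡ true) pairs
    kernel-ok   : All (λ u → noRepeat (L ^ jA) (map (λ q → A₂ * suc q / A₁) (upTo (A₁ * L))) (kernelModel k jA u) ≡ true) pairs

    -- For a repetition of length a and period p, A₁ (ℓ + 1) ≤ A₂ q, 2 q ≤ p < (k - 2) a
    -- and a ≤ 3 (ℓ + 1) + k give slack · a < 2 A₁ k.
    slack a₀    : ℕ
    slack≡      : 2 * A₁ ≡ 3 * (A₂ * (2 + K)) + slack
    a₀-large    : 2 * A₁ * k ≤ slack * a₀
    k+4≤a₀      : k + 4 ≤ a₀

    jW          : ℕ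
    -- With period below `(2 + K) * a` a pair spans at most `(3 + K) * a` letters. Repetitions are
    -- checked up to `a₀` and mirrored pairs up to `N + k`.
    model-len   : All (λ u → (block jW u + (3 + K) * (a₀ ⊔ (N + k)) ≤ᵇ length (model k jW u)) ≡ true) pairs
    repeat-ok   : All (λ u → noRepeat (block jW u) (map (λ p → suc p / (2 + K)) (upTo ((2 + K) * a₀))) (model k jW u) ≡ true) pairs
    -- The position tried is the last letter of x, up to `N + k` beyond the start of x. In terms of
    -- the gap, p < (k-2) a reads b < (k-3) a.
    reverse-ok  : All (λ u → noMirror (block jW u + (N + k)) (map (λ b → b / (1 + K)) (upTo ((1 + K) * (N + k)))) [] (model k jW u) ≡ true) pairs

not-true : ∀ {b} → not b ≡ true → b ≡ true → ⊥
not-true {true} () _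

euclid : ∀ d .{{_ : NonZero d}} m → ∃₂ λ M o → m ≡ d * M + o × o < d
euclid d m = m / d , m % d ,
  trans (m≡m%n+[m/n]*n m d) (trans (+-comm (m % d) _) (cong (_+ m % d) (*-comm (m / d) d))) , m%n<n m d

m<n*suc[m/n] : ∀ m n .{{_ : NonZero n}} → m < n * suc (m / n)
m<n*suc[m/n] m n = begin-strict
  m                    ≡⟨ m≡m%n+[m/n]*n m n ⟩
  m % n + m / n * n    <⟨ +-monoˡ-< (m / n * n) (m%n<n m n) ⟩
  suc (m / n) * n      ≡⟨ *-comm (suc (m / n)) n ⟩
  n * suc (m / n)      ∎
  where open ≤-Reasoning

-- Kernel repetitions and desubstitution

module Avoidance {K L : ℕ} {F T w : ℕ → ℕ} (cert : Certificate K L) (F-bin : ∀ n → Binary (F n))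
            (occ-f : ∀ n → Occ F (L * n) (fOf (4 + K) (F n))) (occ-g : ∀ m → Occ T (Gaps.G F m) (g (F m)))
            (dec : Decoded (suc K) T w) where

  open Certificate cert
  open Coded uniform F-bin occ-f occ-g
  open Ranks T-code no-33 dec

  instance
    L≢0 : NonZero L
    L≢0 = >-nonZero (≤-trans (s≤s z≤n) 2≤L)

  s : ℕ → List ℕ
  s m = S (G m)

  S-occ : ∀ {n} u → Occ T n u → S (n + length u) ≡ mvs u (S n)
  S-occ {n} []      _            = cong S (+-identityʳ n)
  S-occ {n} (t ∷ u) (refl , occ) =
    trans (cong S (+-suc n (length u))) (trans (S-occ u occ) (cong (mvs u) (S-suc n)))

  S-back : ∀ {m n} u → Occ T m u → Occ T n u → S (m + length u) ≡ S (n + length u) → S m ≡ S n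
  S-back {m} {n} []      _            _          eq = trans (cong S (sym (+-identityʳ m))) (trans eq (cong S (+-identityʳ n)))
  S-back {m} {n} (t ∷ u) (refl , occ) (t≡ , occ′) eq =
    mv-injective (T-code m) (S m) (S n) (long m) (long n)
      (trans (sym (S-suc m)) (trans (S-back u occ occ′ (trans (cong S (sym (+-suc m _))) (trans eq (cong S (+-suc n _)))))
        (trans (S-suc n) (cong (λ x → mv x (S n)) t≡))))
    where
    long : ∀ n → 3 ≤ length (S n)
    long n = subst (3 ≤_) (sym (S-length n)) (s≤s (s≤s (s≤s z≤n)))

  s-back : ∀ {m n} u → Occ F m u → Occ F n u → s (m + length u) ≡ s (n + length u) → s m ≡ s n
  s-back u occ occ′ eq = S-back (g* u) (occ-g* u occ) (occ-g* u occ′)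
    (trans (cong S (sym (G-occ u occ))) (trans eq (cong S (G-occ u occ′))))

  s-suc : ∀ m → s (suc m) ≡ mvs (g (F m)) (s m)
  s-suc m = S-occ (g (F m)) (occ-g m)

  s-forward : ∀ {m n} ℓ → s m ≡ s n → (∀ {t} → t < ℓ → F (m + t) ≡ F (n + t)) → s (m + ℓ) ≡ s (n + ℓ)
  s-forward {m} {n} zero    eq _  = trans (cong s (+-identityʳ m)) (trans eq (cong s (sym (+-identityʳ n))))
  s-forward {m} {n} (suc ℓ) eq Fs = begin
    s (m + suc ℓ)                        ≡⟨ cong s (+-suc m ℓ) ⟩
    s (suc (m + ℓ))                      ≡⟨ s-suc (m + ℓ) ⟩
    mvs (g (F (m + ℓ))) (s (m + ℓ))      ≡⟨ cong₂ (mvs ∘ g) (Fs ≤-refl) (s-forward ℓ eq (λ t< → Fs (m≤n⇒m≤1+n t<))) ⟩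
    mvs (g (F (n + ℓ))) (s (n + ℓ))      ≡⟨ sym (s-suc (n + ℓ)) ⟩
    s (suc (n + ℓ))                      ≡⟨ cong s (sym (+-suc n ℓ)) ⟩
    s (n + suc ℓ)                        ∎
    where open ≡-Reasoning

  -- Reading `f (F n)` after `E` amounts to reading `F n` before `E`. As `E` fixes the initial
  -- ranking, the conjugation holds along all of F.
  s-E : ∀ n → s (L * n) ≡ E (s n)
  s-E zero    = trans (cong s (*-zeroʳ L)) (trans S-zero (trans (sym E-start) (cong E (sym S-zero))))
  s-E (suc n) = begin
    s (L * suc n)                                  ≡⟨ cong s (trans (*-suc L n) (+-comm L (L * n))) ⟩
    s (L * n + L)                                  ≡⟨ cong (λ l → s (L * n + l)) (sym (f-len (F-bin n))) ⟩
    s (L * n + length (f (F n)))                   ≡⟨ cong S (G-occ (f (F n)) (occ-f n)) ⟩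
    S (G (L * n) + length (g* (f (F n))))          ≡⟨ S-occ _ (occ-g* _ (occ-f n)) ⟩
    mvs (g* (f (F n))) (s (L * n))                 ≡⟨ cong (mvs (g* (f (F n)))) (s-E n) ⟩
    mvs (g* (f (F n))) (E (s n))                   ≡⟨ E-act (F-bin n) (s n) (S-length (G n)) ⟩
    E (mvs (g (F n)) (s n))                        ≡⟨ cong E (sym (s-suc n)) ⟩
    E (s (suc n))                                  ∎
    where open ≡-Reasoning

  s-L-injective : ∀ {m n} → s (L * m) ≡ s (L * n) → s m ≡ s n
  s-L-injective {m} {n} eq = E-injective (S-perm (G m)) (S-perm (G n)) (trans (sym (s-E m)) (trans eq (s-E n)))

  pair-at : ℕ → List ℕ
  pair-at M = F M ∷ F (suc M) ∷ []

  pair-∈ : ∀ M → pair-at M ∈ pairs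
  pair-∈ M = ∈-pairs (F-bin M) (F-bin (suc M))

  occ-pair : ∀ j M → Occ F (L ^ j * M) (iter j f* (pair-at M))
  occ-pair j M = occ-iter j (pair-at M) (refl , refl , tt)

  occ-codes : ∀ h {m} u → Occ F m u → Occ (λ n → code (map h (s n))) m (codes u (map h (s m)))
  occ-codes h     []      _            = refl , tt
  occ-codes h {m} (x ∷ u) (refl , occ) = refl ,
    subst (Occ _ (suc m)) (cong (codes u) (sym (trans (mvs-map h (g (F m)) (s m)) (cong (map h) (sym (s-suc m)))))) (occ-codes h u occ)

  -- Equality of rankings is asked at the start only; `s-forward` carries it along the equal
  -- letters.
  Kernel : ℕ → ℕ → ℕ → Set
  Kernel m q ℓ = s m ≡ s (m + q) × (∀ {t} → t < ℓ → F (m + t) ≡ F (m + q + t))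

  map-index-S : ∀ n → map (index (S n)) (S n) ≡ upTo k
  map-index-S n = trans (map-index (S-distinct n)) (cong upTo (S-length n))

  -- A kernel repetition of length ℓ makes ℓ + 1 consecutive rankings recur at distance q. A
  -- violation of the bound would thus give more than `A₂ * q / A₁` recurring rankings, which
  -- `kernel-ok` excludes.
  kernel-short : ∀ {m q ℓ} → 1 ≤ q → ℓ < L → Kernel m q ℓ → A₁ * suc ℓ ≤ A₂ * q
  kernel-short {m} {suc d} {ℓ} _ ℓ<L (s≡ , F≡) with A₁ * suc ℓ ≤? A₂ * suc d
  ... | yes le = le
  ... | no  nle with euclid (L ^ jA) {{m^n≢0 L jA}} m
  ... | M , o , m≡ , o< = ⊥-elim (occ-noRepeat (kernelModel k jA (pair-at M)) occ (λ q → A₂ * suc q / A₁) (A₁ * L)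
      (L ^ jA) (All.lookup kernel-ok (pair-∈ M)) o< d<
      (≤-trans bound (≤ᵇ-true (All.lookup kernel-len (pair-∈ M))))
      λ {t} t≤ → cong (code ∘ map h) (subst₂ (λ x y → s (x + t) ≡ s (y + t)) m≡ (cong (_+ suc d) m≡)
        (s-forward t s≡ (λ t′< → F≡ (<-≤-trans t′< (≤-trans t≤ c≤))))))
    where
    open ≤-Reasoning
    lt : A₂ * suc d < A₁ * suc ℓ
    lt = ≰⇒> nle
    h = index (s (L ^ jA * M))
    occ : Occ (λ n → code (map h (s n))) (L ^ jA * M) (kernelModel k jA (pair-at M))
    occ = subst (λ x → Occ (λ n → code (map h (s n))) (L ^ jA * M) (codes (iter jA f* (pair-at M)) x)) (map-index-S (G (L ^ jA * M)))
            (occ-codes h _ (occ-pair jA M))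
    c≤ : A₂ * suc d / A₁ ≤ ℓ
    c≤ = ≤-pred (m<n*o⇒m/o<n (subst (A₂ * suc d <_) (*-comm A₁ (suc ℓ)) lt))
    -- Since `A₂` is nonzero, a violation with ℓ < L has a period within the range tested by the
    -- certificate.
    d< : suc d ≤ A₁ * L
    d< = begin
      suc d         ≤⟨ m≤n*m (suc d) A₂ ⟩
      A₂ * suc d    ≤⟨ <⇒≤ lt ⟩
      A₁ * suc ℓ    ≤⟨ *-monoʳ-≤ A₁ ℓ<L ⟩
      A₁ * L        ∎
    bound : o + suc d + A₂ * suc d / A₁ < L ^ jA + (A₁ * L + L)
    bound = begin-strict
      o + suc d + A₂ * suc d / A₁     ≡⟨ +-assoc o (suc d) _ ⟩
      o + (suc d + A₂ * suc d / A₁)   <⟨ +-mono-<-≤ o< (+-mono-≤ d< (≤-trans c≤ (<⇒≤ ℓ<L))) ⟩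
      L ^ jA + (A₁ * L + L)           ∎

  agree-at : ∀ {m m′} c xs ys → Occ F m xs → Occ F m′ ys → c ≤ length xs → c ≤ length ys →
             (∀ {t} → t < c → F (m + t) ≡ F (m′ + t)) → agree c xs ys ≡ true
  agree-at c xs ys occ occ′ c≤ c≤′ F≡ = agree-complete c xs ys c≤ c≤′ λ t< →
    trans (sym (occ-nth xs occ (<-≤-trans t< c≤))) (trans (F≡ t<) (occ-nth ys occ′ (<-≤-trans t< c≤′)))

  phase-at : ∀ M {o} → o < L → ∃ λ u → (o , u) ∈ phases × Occ F (L * M + o) u × L ≤ length u
  phase-at M {o} o<L = take L (drop o (f* (pair-at M))) , ∈phases ,
    occ-take L _ (occ-drop o _ (occ-f* (pair-at M) (refl , refl , tt))) ,
    ≤ᵇ-true (all-sound _ phases phase-len ∈phases)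
    where
    ∈phases : (o , take L (drop o (f* (pair-at M)))) ∈ phases
    ∈phases = ∈-concatMap⁺ phasesOf (lose (pair-∈ M) (∈-map⁺ (λ o → o , take L (drop o (f* (pair-at M)))) (∈-upTo⁺ o<L)))

  synchronised : ∀ {M M′ o o′} → o < L → o′ < L →
                 (∀ {t} → t < L → F (L * M + o + t) ≡ F (L * M′ + o′ + t)) → o ≡ o′
  synchronised {M} {M′} {o} {o′} o<L o′<L F≡ with phase-at M o<L | phase-at M′ o′<L
  ... | u , u∈ , occ , len | u′ , u′∈ , occ′ , len′
    with o ≡ᵇ o′ in eq | all-sound _ phases (all-sound _ phases phase-ok u∈) u′∈ | agree-at L u u′ occ occ′ len len′ F≡
  ... | true  | _  | _ = ≡ᵇ⇒≡ o o′ (subst Bool.T (sym eq) tt)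
  ... | false | ok | agr = ⊥-elim (not-true ok agr)

  last-letter : ∀ n → F (L * n + (L ∸ 1)) ≡ nth (f (F n)) (L ∸ 1)
  last-letter n = occ-nth (f (F n)) (occ-f n) (subst (L ∸ 1 <_) (sym (f-len (F-bin n))) (∸-monoʳ-< {L} {1} {0} (s≤s z≤n) (≤-trans (s≤s z≤n) 2≤L)))

  last-determines : ∀ {x y} → Binary x → Binary y → nth (f x) (L ∸ 1) ≡ nth (f y) (L ∸ 1) → x ≡ y
  last-determines (inj₁ refl) (inj₁ refl) _  = refl
  last-determines (inj₁ refl) (inj₂ refl) eq = ⊥-elim (last-differ eq)
  last-determines (inj₂ refl) (inj₁ refl) eq = ⊥-elim (last-differ (sym eq))
  last-determines (inj₂ refl) (inj₂ refl) _  = refl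

  block-start : ∀ {M M′ o} → o < L → F M ≡ F M′ → s (L * M + o) ≡ s (L * M′ + o) → s (L * M) ≡ s (L * M′)
  block-start {M} {M′} {o} o<L F≡ eq = s-back v (occ-take o _ (occ-f M))
      (subst (λ x → Occ F (L * M′) (take o (f x))) (sym F≡) (occ-take o _ (occ-f M′)))
      (subst (λ l → s (L * M + l) ≡ s (L * M′ + l)) (sym len) eq)
    where
    v = take o (f (F M))
    len : length v ≡ o
    len = trans (length-take o (f (F M))) (m≤n⇒m⊓n≡m (subst (o ≤_) (sym (f-len (F-bin M))) (<⇒≤ o<L)))

  -- Induction on the period. If ℓ reaches L, both occurrences have the same offset `o` in their
  -- blocks; then q is `L * q′`, and the covered blocks form a kernel repetition of period `q′`.
  kernel-bound : ∀ {m q ℓ} → Acc _<_ q → 1 ≤ q → Kernel m q ℓ → A₁ * suc ℓ ≤ A₂ * q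
  kernel-bound {m} {q} {ℓ} (acc rec) 1≤q ker@(s≡ , F≡) with ℓ <? L
  ... | yes ℓ<L = kernel-short 1≤q ℓ<L ker
  ... | no  ℓ≮L with euclid L m | euclid L (m + q)
  ... | M , o , refl , o<L | M′ , o′ , m+q≡ , o′<L
    with synchronised {M} {M′} o<L o′<L (λ {t} t< → trans (F≡ (<-≤-trans t< (≮⇒≥ ℓ≮L))) (cong (λ x → F (x + t)) m+q≡))
  ... | refl = begin
    -- Rounding down loses less than one block, so ℓ + 1 is at most `L * suc ℓ′`.
    A₁ * suc ℓ            ≤⟨ *-monoʳ-≤ A₁ (≤-<-trans (m≤n+m ℓ o) (m<n*suc[m/n] (o + ℓ) L)) ⟩
    A₁ * (L * suc ℓ′)     ≡⟨ solve 3 (λ a l x → a :* (l :* x) := l :* (a :* x)) refl A₁ L (suc ℓ′) ⟩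
    L * (A₁ * suc ℓ′)     ≤⟨ *-monoʳ-≤ L (kernel-bound (rec q′<q) 1≤q′ (s≡′ , F≡′)) ⟩
    L * (A₂ * q′)         ≡⟨ solve 3 (λ a l x → l :* (a :* x) := a :* (l :* x)) refl A₂ L q′ ⟩
    A₂ * (L * q′)         ≡⟨ cong (A₂ *_) (sym q≡) ⟩
    A₂ * q                ∎
    where
    open ≤-Reasoning
    open +-*-Solver
    -- The number of blocks whose last letter lies in the repetition; the first of them may be
    -- covered only from offset `o` on.
    ℓ′ = (o + ℓ) / L
    LM+q : L * M + q ≡ L * M′
    LM+q = +-cancelʳ-≡ o _ _ (trans (solve 3 (λ a b c → a :+ c :+ b := a :+ b :+ c) refl (L * M) o q) m+q≡)
    M<M′ : M < M′
    M<M′ = *-cancelˡ-< L M M′ (subst (L * M <_) LM+q (m<m+n (L * M) 1≤q))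
    q′ = M′ ∸ M
    M+q′ : M + q′ ≡ M′
    M+q′ = m+[n∸m]≡n (<⇒≤ M<M′)
    1≤q′ : 1 ≤ q′
    1≤q′ = m<n⇒0<n∸m M<M′
    q≡ : q ≡ L * q′
    q≡ = +-cancelˡ-≡ (L * M) _ _ (trans LM+q (trans (cong (L *_) (sym M+q′)) (*-distribˡ-+ L M q′)))
    q′<q : q′ < q
    q′<q = subst (q′ <_) (sym q≡) (subst (q′ <_) (*-comm q′ L) (m<m*n q′ L {{>-nonZero 1≤q′}} 2≤L))
    F-blocks : ∀ {t} → t < ℓ′ → F (M + t) ≡ F (M′ + t)
    F-blocks {t} t< = last-determines (F-bin (M + t)) (F-bin (M′ + t))
      (trans (sym (last-letter (M + t))) (trans (subst₂ (λ a b → F a ≡ F b) pos pos′ (F≡ x<ℓ)) (last-letter (M′ + t))))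
      where
      x = L * t + (L ∸ 1) ∸ o
      o≤ : o ≤ L * t + (L ∸ 1)
      o≤ = ≤-trans (≤-pred (subst (suc o ≤_) (sym (m+[n∸m]≡n (≤-trans (s≤s z≤n) 2≤L))) o<L)) (m≤n+m (L ∸ 1) (L * t))
      o+x : o + x ≡ L * t + (L ∸ 1)
      o+x = m+[n∸m]≡n o≤
      x<ℓ : x < ℓ
      x<ℓ = +-cancelˡ-< o x ℓ (begin-strict
        o + x                   ≡⟨ o+x ⟩
        L * t + (L ∸ 1)         <⟨ +-monoʳ-< (L * t) (∸-monoʳ-< {L} {1} {0} (s≤s z≤n) (≤-trans (s≤s z≤n) 2≤L)) ⟩
        L * t + L               ≡⟨ solve 2 (λ l t → l :* t :+ l := (con 1 :+ t) :* l) refl L t ⟩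
        suc t * L               ≤⟨ *-monoˡ-≤ L t< ⟩
        ℓ′ * L                  ≤⟨ m/n*n≤m (o + ℓ) L ⟩
        o + ℓ                   ∎)
      pos : L * M + o + x ≡ L * (M + t) + (L ∸ 1)
      pos = trans (+-assoc (L * M) o x) (trans (cong (L * M +_) o+x)
              (solve 4 (λ l m t r → l :* m :+ (l :* t :+ r) := l :* (m :+ t) :+ r) refl L M t (L ∸ 1)))
      pos′ : L * M + o + q + x ≡ L * (M′ + t) + (L ∸ 1)
      pos′ = trans (cong (_+ x) m+q≡) (trans (+-assoc (L * M′) o x) (trans (cong (L * M′ +_) o+x)
              (solve 4 (λ l m t r → l :* m :+ (l :* t :+ r) := l :* (m :+ t) :+ r) refl L M′ t (L ∸ 1))))
    F≡′ : ∀ {t} → t < ℓ′ → F (M + t) ≡ F (M + q′ + t)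
    F≡′ {t} t< = trans (F-blocks t<) (cong (λ x → F (x + t)) (sym M+q′))
    -- Rankings are known to agree at offset `o`, but `E` can be inverted only at a block boundary.
    -- As ℓ is at least L, the first blocks are images of equal letters, so `o` letters can be
    -- undone.
    s≡′ : s M ≡ s (M + q′)
    s≡′ = trans (s-L-injective {M} {M′} (block-start {M} {M′} o<L
             (subst₂ (λ a b → F a ≡ F b) (+-identityʳ M) (+-identityʳ M′) (F-blocks (m≥n⇒m/n>0 (≤-trans (≮⇒≥ ℓ≮L) (m≤n+m ℓ o)))))
             (trans s≡ (cong s m+q≡)))) (cong s (sym M+q′))

  -- Short powers, by comparison with the finite models

  T-block : ∀ j i → ∃₂ λ M o → i ≡ G (L ^ j * M) + o × o < length (g* (iter j f* (F M ∷ [])))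
  T-block j i with locate i
  ... | m , o , i≡ , o< with euclid (L ^ j) {{m^n≢0 L j}} m
  ... | M , r , m≡ , r< = M , i ∸ G (L ^ j * M) , sym (m+[n∸m]≡n lower) ,
      +-cancelˡ-< (G (L ^ j * M)) _ _ (subst₂ _<_ (sym (m+[n∸m]≡n lower)) next upper)
    where
    open ≤-Reasoning
    v = iter j f* (F M ∷ [])
    lower : G (L ^ j * M) ≤ i
    lower = begin
      G (L ^ j * M)   ≤⟨ G-mono (≤-trans (m≤m+n (L ^ j * M) r) (≤-reflexive (sym m≡))) ⟩
      G m             ≤⟨ m≤m+n (G m) o ⟩
      G m + o         ≡⟨ sym i≡ ⟩
      i               ∎
    len : length v ≡ L ^ j
    len = trans (iter-len j (F-bin M ∷ [])) (*-identityʳ (L ^ j))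
    next : G (L ^ j * M + L ^ j) ≡ G (L ^ j * M) + length (g* v)
    next = trans (cong (λ l → G (L ^ j * M + l)) (sym len)) (G-occ v (occ-iter j (F M ∷ []) (refl , tt)))
    upper : i < G (L ^ j * M + L ^ j)
    upper = begin-strict
      i                       ≡⟨ i≡ ⟩
      G m + o                 <⟨ +-monoʳ-< (G m) o< ⟩
      G (suc m)               ≤⟨ G-mono (subst (_≤ L ^ j * M + L ^ j) (trans (+-suc _ r) (cong suc (sym m≡))) (+-monoʳ-≤ (L ^ j * M) r<)) ⟩
      G (L ^ j * M + L ^ j)   ∎

  occ-outs : ∀ h {n} u → Occ T n u → Occ (h ∘ w) (n + (3 + K)) (outs u (map h (S n)))
  occ-outs h     []      _            = tt
  occ-outs h {n} (t ∷ u) (refl , occ) =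
    trans (cong h (w-out n)) (sym (nth-map h (S n) (subst (T n ∸ 1 <_) (sym (S-length n)) (bound (T-code n))))) ,
    subst (Occ (h ∘ w) (suc (n + (3 + K)))) (cong (outs u) (trans (cong (map h) (S-suc n)) (sym (mv-map h (T n) (S n))))) (occ-outs h u occ)
    where
    bound : ∀ {t} → Code t → t ∸ 1 < 4 + K
    bound (inj₁ refl)        = s≤s z≤n
    bound (inj₂ (inj₁ refl)) = s≤s (s≤s z≤n)
    bound (inj₂ (inj₂ refl)) = s≤s (s≤s (s≤s z≤n))

  occ-map : ∀ {v : ℕ → ℕ} (h : ℕ → ℕ) {n} u → Occ v n u → Occ (h ∘ v) n (map h u)
  occ-map h []      _          = tt
  occ-map h (x ∷ u) (eq , occ) = cong h eq , occ-map h u occ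

  -- By `occ-tail` the ranking at a 3 spells `w` from that same index on. So the model starts in `w`
  -- where its block starts in `T`, and `T-block` may be applied to positions of `w`.
  occ-model : ∀ j M → let n = G (L ^ j * M) in Occ (index (S n) ∘ w) n (model k j (pair-at M))
  occ-model j M = occ-++ (drop 1 (upTo k))
      (subst (Occ (h ∘ w) n) (trans (sym (drop-map 1 (S n))) (cong (drop 1) (map-index-S n))) (occ-map h (drop 1 (S n)) (occ-tail n (T-G (L ^ j * M)))))
      (subst₂ (λ l s → Occ (h ∘ w) (n + l) (outs (g* (iter j f* (pair-at M))) s)) (sym len) (map-index-S n)
        (occ-outs h _ (occ-g* _ (occ-pair j M))))
    where
    n = G (L ^ j * M)
    h = index (S n)
    len : length (drop 1 (upTo k)) ≡ 3 + K
    len = trans (length-drop 1 (upTo k)) (cong pred (length-upTo k))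

  no-short-repeat : ∀ i a p → 1 ≤ p → p < (2 + K) * a → a ≤ a₀ → ¬ (∀ {t} → t < a → w (i + t) ≡ w (i + p + t))
  no-short-repeat i a (suc d) _ p< a≤ w≡ with T-block jW i
  ... | M , o , refl , o< = occ-noRepeat (model k jW (pair-at M)) (occ-model jW M) (λ p → suc p / (2 + K)) ((2 + K) * a₀)
      (block jW (pair-at M)) (All.lookup repeat-ok (pair-∈ M)) o< (≤-trans (<⇒≤ p<) (*-monoʳ-≤ (2 + K) a≤))
      (<-≤-trans bound (≤ᵇ-true (All.lookup model-len (pair-∈ M))))
      (λ t≤ → cong (index (S (G (L ^ jW * M)))) (w≡ (≤-<-trans t≤ c<)))
    where
    open ≤-Reasoning
    c< : suc d / (2 + K) < a
    c< = m<n*o⇒m/o<n (subst (suc d <_) (*-comm (2 + K) a) p<)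
    bound : o + suc d + suc d / (2 + K) < block jW (pair-at M) + (3 + K) * (a₀ ⊔ (N + k))
    bound = begin-strict
      o + suc d + suc d / (2 + K)        ≡⟨ +-assoc o (suc d) _ ⟩
      o + (suc d + suc d / (2 + K))      <⟨ +-mono-<-≤ o< (+-mono-≤ (<⇒≤ p<) (<⇒≤ c<)) ⟩
      block jW (pair-at M) + ((2 + K) * a + a)   ≡⟨ cong (block jW (pair-at M) +_) (+-comm ((2 + K) * a) a) ⟩
      block jW (pair-at M) + (3 + K) * a         ≤⟨ +-monoʳ-≤ (block jW (pair-at M)) (*-monoʳ-≤ (3 + K) (≤-trans a≤ (m≤m⊔n a₀ (N + k)))) ⟩
      block jW (pair-at M) + (3 + K) * (a₀ ⊔ (N + k)) ∎

  no-short-mirror : ∀ i a b → b < (1 + K) * a → a ≤ N + k →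
                    ¬ (∀ {t s} → suc (t + s) ≡ a → w (i + a + b + t) ≡ w (i + s))
  no-short-mirror i zero    b b< a≤ w≡ = n≮0 (subst (b <_) (*-zeroʳ (1 + K)) b<)
  no-short-mirror i (suc e) b b< a≤ w≡ with T-block jW i
  ... | M , o , refl , o< = occ-noMirror (model k jW (pair-at M)) (occ-model jW M) (λ b → b / (1 + K)) ((1 + K) * (N + k))
      -- `o + e` is the last letter of x, from which the check reads backwards; x′ begins `suc b`
      -- places later.
      (block jW (pair-at M) + (N + k)) (All.lookup reverse-ok (pair-∈ M)) {o + e} {b}
      (+-mono-<-≤ o< (<⇒≤ a≤)) (<-≤-trans b< (*-monoʳ-≤ (1 + K) a≤)) (≤-trans c≤ (m≤n+m e o))
      (<-≤-trans bound (≤ᵇ-true (All.lookup model-len (pair-∈ M))))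
      λ {t} {s} t≤ t+s≡ → cong (index (S n)) (trans (cong w (pos t s t+s≡ (≤-trans t≤ c≤))) (trans (sym (w≡ (cong suc (m+[n∸m]≡n (≤-trans t≤ c≤)))))
        (cong w (solve 5 (λ n o e b t → n :+ o :+ (con 1 :+ e) :+ b :+ t := n :+ (o :+ e) :+ (con 1 :+ b) :+ t) refl n o e b t))))
    where
    open ≤-Reasoning
    open +-*-Solver
    n = G (L ^ jW * M)
    c≤ : b / (1 + K) ≤ e
    c≤ = ≤-pred (m<n*o⇒m/o<n (subst (b <_) (*-comm (1 + K) (suc e)) b<))
    pos : ∀ t s → t + s ≡ o + e → t ≤ e → n + s ≡ n + o + (e ∸ t)
    pos t s t+s≡ t≤e = trans (cong (n +_) (+-cancelˡ-≡ t _ _ (trans t+s≡ (trans (cong (o +_) (sym (m+[n∸m]≡n t≤e)))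
      (solve 3 (λ o t r → o :+ (t :+ r) := t :+ (o :+ r)) refl o t (e ∸ t)))))) (sym (+-assoc n o (e ∸ t)))
    B = block jW (pair-at M)
    bound : o + e + suc b + b / (1 + K) < B + (3 + K) * (a₀ ⊔ (N + k))
    bound = begin-strict
      o + e + suc b + b / (1 + K)                 ≡⟨ solve 4 (λ o e b c → o :+ e :+ b :+ c := o :+ (e :+ (b :+ c))) refl o e (suc b) (b / (1 + K)) ⟩
      o + (e + (suc b + b / (1 + K)))             <⟨ +-mono-<-≤ o< (+-mono-≤ (n≤1+n e) (+-mono-≤ b< (≤-trans c≤ (n≤1+n e)))) ⟩
      B + (suc e + ((1 + K) * suc e + suc e))     ≡⟨ cong (B +_) (solve 2 (λ x K → x :+ ((con 1 :+ K) :* x :+ x) := (con 3 :+ K) :* x) refl (suc e) K) ⟩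
      B + (3 + K) * suc e                         ≤⟨ +-monoʳ-≤ B (*-monoʳ-≤ (3 + K) (≤-trans a≤ (m≤n⊔m a₀ (N + k)))) ⟩
      B + (3 + K) * (a₀ ⊔ (N + k))                ∎

  -- Long mirrored pairs

  triple-∈ : ∀ n → F n ∷ F (suc n) ∷ F (suc (suc n)) ∷ [] ∈ triples
  triple-∈ n with euclid L n
  ... | M , o , refl , o<L = subst (_∈ triples) (exact _ len (occ-take 3 _ (occ-drop o _ (occ-f* (pair-at M) (refl , refl , tt)))))
      (∈-deduplicate⁺ (≡-dec _≟_) (∈-concatMap⁺ (windows 3 L ∘ f*) (lose (pair-∈ M) (∈-windows 3 (f* (pair-at M)) o<L))))
    where
    open ≤-Reasoning
    exact : ∀ {m} u → length u ≡ 3 → Occ F m u → u ≡ F m ∷ F (suc m) ∷ F (suc (suc m)) ∷ []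
    exact (_ ∷ _ ∷ _ ∷ []) _ (refl , refl , refl , _) = refl
    room : o + 3 ≤ length (f* (pair-at M))
    room = begin
      o + 3          ≡⟨ trans (+-suc o 2) refl ⟩
      suc o + 2      ≤⟨ +-mono-≤ o<L 2≤L ⟩
      L + L          ≡⟨ solve 1 (λ l → l :+ l := l :* con 2) refl L ⟩
      L * 2          ≡⟨ sym (f*-len (F-bin M ∷ F-bin (suc M) ∷ [])) ⟩
      length (f* (pair-at M)) ∎
      where open +-*-Solver
    len : length (take 3 (drop o (f* (pair-at M)))) ≡ 3
    len = trans (length-take 3 (drop o (f* (pair-at M)))) (m≤n⇒m⊓n≡m
      (subst (3 ≤_) (sym (length-drop o (f* (pair-at M)))) (subst (_≤ length (f* (pair-at M)) ∸ o) (m+n∸m≡n o 3) (∸-monoˡ-≤ o room))))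

  code-window : ∀ i → ∃ λ u → u ∈ codeWindows N jN × Occ T i u × length u ≡ N
  code-window i with T-block jN i
  ... | M , o , refl , o< = u , u∈ ,
      occ-take N _ (occ-drop o _ (occ-g* _ (occ-iter jN triple (refl , refl , refl , tt)))) ,
      ≤-antisym (subst (_≤ N) (sym (length-take N v)) (m⊓n≤m N (length v))) (≤ᵇ-true (all-sound (λ u → N ≤ᵇ length u) _ mirror-len u∈))
    where
    triple = F M ∷ F (suc M) ∷ F (suc (suc M)) ∷ []
    v = drop o (g* (iter jN f* triple))
    u = take N v
    u∈ : u ∈ codeWindows N jN
    u∈ = ∈-concatMap⁺ (codeWindowsOf N jN) (lose (triple-∈ M) (∈-windows N (g* (iter jN f* triple)) o<))

  mark-≡ : ∀ {a b} → (a ≡ 3 → b ≡ 3) → (b ≡ 3 → a ≡ 3) → mark a ≡ mark b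
  mark-≡ {a} {b} to from with a ≟ 3 | b ≟ 3
  ... | yes refl | yes refl = refl
  ... | yes refl | no  b≢3  = ⊥-elim (b≢3 (to refl))
  ... | no  a≢3  | yes refl = ⊥-elim (a≢3 (from refl))
  ... | no  a≢3  | no  b≢3  rewrite ≢⇒≡ᵇ a≢3 | ≢⇒≡ᵇ b≢3 = refl

  no-mirrored-marks : ∀ i i′ → ¬ (∀ {x y} → suc (x + y) ≡ N → mark (T (i + x)) ≡ mark (T (i′ + y)))
  no-mirrored-marks i i′ mir with code-window i | code-window i′
  ... | u , u∈ , occ , len | v , v∈ , occ′ , len′ =
    not-true (all-sound _ _ (all-sound _ _ mirror-ok (∈-map⁺ marks u∈)) (∈-map⁺ (reverse ∘ marks) v∈))
      (agree-complete N (marks u) (reverse (marks v))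
        (≤-reflexive (sym (trans (length-map mark u) len)))
        (≤-reflexive (sym (trans (length-reverse (marks v)) (trans (length-map mark v) len′)))) same)
    where
    same : ∀ {t} → t < N → nth (marks u) t ≡ nth (reverse (marks v)) t
    same {t} t<N = begin
      nth (marks u) t              ≡⟨ nth-map mark u (subst (t <_) (sym len) t<N) ⟩
      mark (nth u t)               ≡⟨ cong mark (sym (occ-nth u occ (subst (t <_) (sym len) t<N))) ⟩
      mark (T (i + t))             ≡⟨ mir t+y ⟩
      mark (T (i′ + y))            ≡⟨ cong mark (occ-nth v occ′ (subst (y <_) (sym len′) y<N)) ⟩
      mark (nth v y)               ≡⟨ sym (nth-map mark v (subst (y <_) (sym len′) y<N)) ⟩
      nth (marks v) y              ≡⟨ sym (nth-reverse (marks v) (trans t+y (sym (trans (length-map mark v) len′)))) ⟩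
      nth (reverse (marks v)) t    ∎
      where
      open ≡-Reasoning
      y = N ∸ suc t
      t+y : suc (t + y) ≡ N
      t+y = m+[n∸m]≡n t<N
      y<N : y < N
      y<N = subst (y <_) t+y (s≤s (m≤n+m y t))

  -- The positions n + 1 and n + k - 1 that a 3 ties together go under the mirror to another such
  -- pair with its ends exchanged. Hence the 3-marks of x reappear reversed in x′.
  no-long-mirror : ∀ i a b → N + k ≤ a → ¬ (∀ {t s} → suc (t + s) ≡ a → w (i + a + b + t) ≡ w (i + s))
  no-long-mirror i a b a≥ w≡ = no-mirrored-marks i (i′ + y₀) λ {x} {y} x+y →
      mark-≡ (to x y x+y) (from x y x+y)
    where
    open +-*-Solver
    i′ = i + a + b
    -- The `N` codes from `i` constrain only the first letters of x. Their mirror images end x′,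
    -- where the `N` codes from `i′ + y₀` constrain them.
    y₀ = a ∸ (N + k)
    module _ (x y : ℕ) (x+y : suc (x + y) ≡ N) where
      n′ = i′ + y₀ + y
      sum≡ : y₀ + y + x + (5 + K) ≡ a
      sum≡ = trans (solve 4 (λ z x y K → z :+ y :+ x :+ (con 5 :+ K) := con 1 :+ (x :+ y) :+ (con 4 :+ K) :+ z) refl y₀ x y K)
               (trans (cong (λ z → z + k + y₀) x+y) (m+[n∸m]≡n a≥))
      fst≡ : w (suc (i + x)) ≡ w (n′ + (3 + K))
      fst≡ = trans (cong w (sym (+-suc i x))) (trans (sym (w≡ {y₀ + y + (3 + K)}
               (trans (solve 3 (λ z x K → con 1 :+ (z :+ (con 3 :+ K) :+ (con 1 :+ x)) := z :+ x :+ (con 5 :+ K)) refl (y₀ + y) x K) sum≡)))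
               (cong w (solve 4 (λ i z y c → i :+ (z :+ y :+ c) := i :+ z :+ y :+ c) refl i′ y₀ y (3 + K))))
      snd≡ : w (i + x + (3 + K)) ≡ w (suc n′)
      snd≡ = trans (cong w (+-assoc i x (3 + K))) (trans (sym (w≡ {suc (y₀ + y)}
               (trans (solve 3 (λ z x K → con 1 :+ (con 1 :+ z :+ (x :+ (con 3 :+ K))) := z :+ x :+ (con 5 :+ K)) refl (y₀ + y) x K) sum≡)))
               (cong w (solve 3 (λ i z y → i :+ (con 1 :+ (z :+ y)) := con 1 :+ (i :+ z :+ y)) refl i′ y₀ y)))
      to : T (i + x) ≡ 3 → T n′ ≡ 3
      to t = w⇒T≡3 n′ (trans (sym snd≡) (trans (sym (T≡3⇒w (i + x) t)) fst≡))
      from : T n′ ≡ 3 → T (i + x) ≡ 3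
      from t = w⇒T≡3 (i + x) (trans fst≡ (trans (sym (T≡3⇒w n′ t)) (sym snd≡)))

  -- Long repetitions

  module LongRepeat (i a p : ℕ) (1≤p : 1 ≤ p) (a₀≤a : a₀ ≤ a) (w≡ : ∀ {t} → t < a → w (i + t) ≡ w (i + p + t)) where
    open ≤-Reasoning
    open +-*-Solver

    shift : ∀ n → i ≤ n → n < i + a → w n ≡ w (n + p)
    shift n i≤n n< = trans (cong w (sym i+x)) (trans (w≡ (+-cancelˡ-< i (n ∸ i) a (subst (_< i + a) (sym i+x) n<)))
        (cong w (trans (solve 3 (λ i p x → i :+ p :+ x := i :+ x :+ p) refl i p (n ∸ i)) (cong (_+ p) i+x))))
      where
      i+x : i + (n ∸ i) ≡ n
      i+x = m+[n∸m]≡n i≤n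

    module _ (n : ℕ) (i≤n : i ≤ n) (n+k≤ : n + k ≤ i + a) where
      fst≡ : w (suc n) ≡ w (suc n + p)
      fst≡ = shift (suc n) (m≤n⇒m≤1+n i≤n) (<-≤-trans (subst (_< n + k) (+-comm n 1) (+-monoʳ-< n {1} {k} (s≤s (s≤s z≤n)))) n+k≤)
      snd≡ : w (n + (3 + K)) ≡ w (n + p + (3 + K))
      snd≡ = trans (shift (n + (3 + K)) (≤-trans i≤n (m≤m+n n (3 + K))) (<-≤-trans (+-monoʳ-< n ≤-refl) n+k≤))
               (cong w (solve 3 (λ n c p → n :+ c :+ p := n :+ p :+ c) refl n (3 + K) p))
      3-forth : T n ≡ 3 → T (n + p) ≡ 3
      3-forth t = w⇒T≡3 (n + p) (trans (sym fst≡) (trans (T≡3⇒w n t) snd≡))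
      3-back : T (n + p) ≡ 3 → T n ≡ 3
      3-back t = w⇒T≡3 n (trans fst≡ (trans (T≡3⇒w (n + p) t) (sym snd≡)))

    -- `G m₀` is a 3 near the start of the repetition and its shift by `p` is 3 number `m₀ + q`, so
    -- the period p of `w` becomes the period q of F.
    module Blocks (m₀ q : ℕ) (i≤G : i ≤ G m₀) (G≤2+i : G m₀ ≤ 2 + i) (room : G m₀ + k ≤ i + a) (1≤q : 1 ≤ q)
                  (T₃ : T (G m₀ + p) ≡ 3) (G-q : G (m₀ + q) ≡ G m₀ + p) where

      states : s m₀ ≡ s (m₀ + q)
      states = trans (S-≡ (G m₀) (G m₀ + p) (T-G m₀) T₃ λ {j} j< →
          trans (shift (G m₀ + j) (≤-trans i≤G (m≤m+n (G m₀) j)) (<-≤-trans (+-monoʳ-< (G m₀) (m≤n⇒m≤1+n j<)) room))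
            (cong w (solve 3 (λ x j p → x :+ j :+ p := x :+ p :+ j) refl (G m₀) j p)))
        (cong S (sym G-q))

      -- The second component keeps the next 3s of both occurrences at distance `p`, ready for the
      -- comparison of one more letter.
      Match : ℕ → Set
      Match ℓ = (∀ {t} → t < ℓ → F (m₀ + t) ≡ F (m₀ + q + t)) × G (m₀ + q + ℓ) ≡ G (m₀ + ℓ) + p

      -- The next letter of F is 1 exactly when a 3 stands two places after the current one, and
      -- inside the repetition 3s transfer both ways under the shift by `p`.
      match-suc : ∀ ℓ → G (m₀ + ℓ) + 2 + k ≤ i + a → Match ℓ → Match (suc ℓ)
      match-suc ℓ fits (Fs , Gs) = all-F , (begin-equality
          G (m₀ + q + suc ℓ)                          ≡⟨ cong G (+-suc (m₀ + q) ℓ) ⟩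
          G (m₀ + q + ℓ) + g-len (F (m₀ + q + ℓ))     ≡⟨ cong₂ (λ x y → x + g-len y) Gs (sym F-last) ⟩
          G (m₀ + ℓ) + p + g-len (F (m₀ + ℓ))         ≡⟨ solve 3 (λ a b c → a :+ b :+ c := a :+ c :+ b) refl (G (m₀ + ℓ)) p _ ⟩
          G (suc (m₀ + ℓ)) + p                        ≡⟨ cong (λ x → G x + p) (sym (+-suc m₀ ℓ)) ⟩
          G (m₀ + suc ℓ) + p                          ∎)
        where
        n = G (m₀ + ℓ) + 2
        i≤n : i ≤ n
        i≤n = ≤-trans i≤G (≤-trans (G-mono (m≤m+n m₀ ℓ)) (m≤m+n (G (m₀ + ℓ)) 2))
        n+p : n + p ≡ G (m₀ + q + ℓ) + 2
        n+p = trans (solve 2 (λ x p → x :+ con 2 :+ p := x :+ p :+ con 2) refl (G (m₀ + ℓ)) p) (cong (_+ 2) (sym Gs))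
        F-last : F (m₀ + ℓ) ≡ F (m₀ + q + ℓ)
        F-last with F-bin (m₀ + ℓ) | F-bin (m₀ + q + ℓ)
        ... | inj₁ x | inj₁ y = trans x (sym y)
        ... | inj₂ x | inj₂ y = trans x (sym y)
        ... | inj₁ x | inj₂ _ = trans x (sym (T-G+2 (trans (cong T (sym n+p))
                (3-forth n i≤n fits (trans (cong T (G+2 x)) (T-G (suc (m₀ + ℓ))))))))
        ... | inj₂ _ | inj₁ y = trans (T-G+2 (3-back n i≤n fits (trans (cong T (trans n+p (G+2 y))) (T-G (suc (m₀ + q + ℓ)))))) (sym y)
        all-F : ∀ {t} → t < suc ℓ → F (m₀ + t) ≡ F (m₀ + q + t)
        all-F {t} (s≤s t≤ℓ) with m≤n⇒m<n∨m≡n t≤ℓ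
        ... | inj₁ t<ℓ  = Fs t<ℓ
        ... | inj₂ refl = F-last

      longest : ∀ n ℓ → i + a ≤ ℓ + n → Match ℓ → ∃ λ ℓ → Match ℓ × i + a < G (m₀ + ℓ) + 2 + k
      longest n ℓ fuel match with G (m₀ + ℓ) + 2 + k ≤? i + a
      ... | no ≰ = ℓ , match , ≰⇒> ≰
      -- Without fuel ℓ is at least `i + a`; 3s being two or more apart, `G (m₀ + ℓ)` would already
      -- lie past the end.
      longest zero ℓ fuel match | yes le = ⊥-elim (<-irrefl refl (begin-strict
        i + a                    ≤⟨ fuel ⟩
        ℓ + 0                    ≤⟨ +-monoʳ-≤ ℓ z≤n ⟩
        2 * ℓ                    ≤⟨ m≤n+m (2 * ℓ) (G m₀) ⟩
        G m₀ + 2 * ℓ             ≤⟨ G-lower m₀ ℓ ⟩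
        G (m₀ + ℓ)               <⟨ m<m+n (G (m₀ + ℓ)) {2} (s≤s z≤n) ⟩
        G (m₀ + ℓ) + 2           ≤⟨ m≤m+n _ k ⟩
        G (m₀ + ℓ) + 2 + k       ≤⟨ le ⟩
        i + a                    ∎))
      longest (suc n) ℓ fuel match | yes le = longest n (suc ℓ) (subst (i + a ≤_) (+-suc ℓ n) fuel) (match-suc ℓ le match)

      -- A longest match stops within k + 2 places of the end, and gaps of at most 3 then bound `a`
      -- by ℓ. Gaps of at least 2 bound q by p. The kernel bound links ℓ to q.
      period-large : ¬ p < (2 + K) * a
      period-large p< with longest (i + a) 0 ≤-refl ((λ ()) , trans (cong G (+-identityʳ (m₀ + q))) (trans G-q (cong (λ x → G x + p) (sym (+-identityʳ m₀)))))
      ... | ℓ , (Fs , _) , end = <-irrefl refl (begin-strict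
          slack * a                                  <⟨ +-cancelˡ-< (3 * (A₂ * (2 + K)) * a) _ _ total ⟩
          2 * A₁ * k                                 ≤⟨ a₀-large ⟩
          slack * a₀                                 ≤⟨ *-monoʳ-≤ slack a₀≤a ⟩
          slack * a                                  ∎)
        where
        kernel : A₁ * suc ℓ ≤ A₂ * q
        kernel = kernel-bound (<-wellFounded q) 1≤q (states , Fs)
        2q≤p : 2 * q ≤ p
        2q≤p = +-cancelˡ-≤ (G m₀) _ _ (≤-trans (G-lower m₀ q) (≤-reflexive G-q))
        a≤ : a ≤ 3 * suc ℓ + k
        a≤ = ≤-pred (+-cancelˡ-≤ i _ _ (begin
          i + suc a                          ≡⟨ +-suc i a ⟩
          suc (i + a)                        ≤⟨ end ⟩
          G (m₀ + ℓ) + 2 + k                 ≤⟨ +-monoˡ-≤ k (+-monoˡ-≤ 2 (≤-trans (G-upper m₀ ℓ) (+-monoˡ-≤ (3 * ℓ) G≤2+i))) ⟩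
          2 + i + 3 * ℓ + 2 + k              ≡⟨ solve 3 (λ i l k → con 2 :+ i :+ con 3 :* l :+ con 2 :+ k := i :+ (con 1 :+ (con 3 :* (con 1 :+ l) :+ k))) refl i ℓ k ⟩
          i + suc (3 * suc ℓ + k)            ∎))
        total : 3 * (A₂ * (2 + K)) * a + slack * a < 3 * (A₂ * (2 + K)) * a + 2 * A₁ * k
        total = begin-strict
          3 * (A₂ * (2 + K)) * a + slack * a           ≡⟨ sym (*-distribʳ-+ a (3 * (A₂ * (2 + K))) slack) ⟩
          (3 * (A₂ * (2 + K)) + slack) * a             ≡⟨ cong (_* a) (sym slack≡) ⟩
          2 * A₁ * a                                   ≤⟨ *-monoʳ-≤ (2 * A₁) a≤ ⟩
          2 * A₁ * (3 * suc ℓ + k)                     ≡⟨ solve 3 (λ A l k → con 2 :* A :* (con 3 :* l :+ k) := con 3 :* (con 2 :* (A :* l)) :+ con 2 :* A :* k) refl A₁ (suc ℓ) k ⟩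
          3 * (2 * (A₁ * suc ℓ)) + 2 * A₁ * k          ≤⟨ +-monoˡ-≤ (2 * A₁ * k) (*-monoʳ-≤ 3 (*-monoʳ-≤ 2 kernel)) ⟩
          3 * (2 * (A₂ * q)) + 2 * A₁ * k              ≡⟨ cong (λ x → 3 * x + 2 * A₁ * k) (solve 2 (λ A q → con 2 :* (A :* q) := A :* (con 2 :* q)) refl A₂ q) ⟩
          3 * (A₂ * (2 * q)) + 2 * A₁ * k              ≤⟨ +-monoˡ-≤ (2 * A₁ * k) (*-monoʳ-≤ 3 (*-monoʳ-≤ A₂ 2q≤p)) ⟩
          3 * (A₂ * p) + 2 * A₁ * k                    <⟨ +-monoˡ-< (2 * A₁ * k) (*-monoʳ-< 3 (*-monoʳ-< A₂ p<)) ⟩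
          3 * (A₂ * ((2 + K) * a)) + 2 * A₁ * k        ≡⟨ cong (_+ 2 * A₁ * k) (solve 3 (λ A K a → con 3 :* (A :* (K :* a)) := con 3 :* (A :* K) :* a) refl A₂ (2 + K) a) ⟩
          3 * (A₂ * (2 + K)) * a + 2 * A₁ * k          ∎

    impossible : ¬ p < (2 + K) * a
    impossible with next-G i
    ... | m₀ , i≤G , G≤2+i = from-partner (T≡3⇒G {G m₀ + p} T₃)
      where
      room : G m₀ + k ≤ i + a
      room = begin
        G m₀ + k         ≤⟨ +-monoˡ-≤ k G≤2+i ⟩
        2 + i + k        ≡⟨ solve 2 (λ i k → con 2 :+ i :+ k := i :+ (k :+ con 2)) refl i k ⟩
        i + (k + 2)      ≤⟨ +-monoʳ-≤ i (≤-trans (+-monoʳ-≤ k (s≤s (s≤s z≤n))) (≤-trans k+4≤a₀ a₀≤a)) ⟩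
        i + a            ∎
      T₃ : T (G m₀ + p) ≡ 3
      T₃ = 3-forth (G m₀) i≤G room (T-G m₀)
      from-partner : (∃ λ m₁ → G m₀ + p ≡ G m₁) → ¬ p < (2 + K) * a
      from-partner (m₁ , eq) = Blocks.period-large m₀ (m₁ ∸ m₀) i≤G G≤2+i room (m<n⇒0<n∸m m₀<m₁) T₃
          (trans (cong G (m+[n∸m]≡n (<⇒≤ m₀<m₁))) (sym eq))
        where
        m₀<m₁ : m₀ < m₁
        m₀<m₁ = G-cancel-< (subst (G m₀ <_) eq (m<m+n (G m₀) 1≤p))

  -- Both kinds of powers excluded

  no-repeat : ∀ i a p → 1 ≤ p → p < (2 + K) * a → ¬ (∀ {t} → t < a → w (i + t) ≡ w (i + p + t))
  no-repeat i a p 1≤p p< w≡ with ≤-total a a₀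
  ... | inj₁ a≤a₀ = no-short-repeat i a p 1≤p p< a≤a₀ w≡
  ... | inj₂ a₀≤a = LongRepeat.impossible i a p 1≤p a₀≤a w≡ p<

  no-mirror : ∀ i a b → b < (1 + K) * a → ¬ (∀ {t s} → suc (t + s) ≡ a → w (i + a + b + t) ≡ w (i + s))
  no-mirror i a b b< w≡ with ≤-total a (N + k)
  ... | inj₁ a≤ = no-short-mirror i a b b< a≤ w≡
  ... | inj₂ a≥ = no-long-mirror i a b a≥ w≡

  undirected-free : UndirectedFreePlus (3 + K) (2 + K) w
  undirected-free i a b big (1≤a , power) = go power
    where
    open +-*-Solver
    p< : a + b < (2 + K) * a
    -- Subtracting (k-2)(a+b) from both sides of the exponent condition leaves a + b < (k-2) a.
    p< = +-cancelʳ-< ((2 + K) * (a + b)) _ _ (subst₂ _<_ refl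
      (solve 3 (λ a b c → (con 2 :* a :+ b) :* c := c :* a :+ c :* (a :+ b)) refl a b (2 + K)) big)
    nth-factor : ∀ j {t} → t < a → nth (factor w j a) t ≡ w (j + t)
    nth-factor j = nth-map-upTo (λ t → w (j + t))
    go : factor w (i + a + b) a ≡ factor w i a ⊎ factor w (i + a + b) a ≡ reverse (factor w i a) → ⊥
    go (inj₁ eq) = no-repeat i a (a + b) (≤-trans 1≤a (m≤m+n a b)) p< λ {t} t<a → begin
      w (i + t)                       ≡⟨ sym (nth-factor i t<a) ⟩
      nth (factor w i a) t            ≡⟨ cong (λ l → nth l t) (sym eq) ⟩
      nth (factor w (i + a + b) a) t  ≡⟨ nth-factor (i + a + b) t<a ⟩
      w (i + a + b + t)               ≡⟨ cong (λ x → w (x + t)) (+-assoc i a b) ⟩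
      w (i + (a + b) + t)             ∎
      where open ≡-Reasoning
    -- `(2 + K) * a` computes to `a + (1 + K) * a`, so cancelling `a` gives the bound on the gap.
    go (inj₂ eq) = no-mirror i a b (+-cancelˡ-< a b _ p<) λ {t} {s} t+s → begin
      w (i + a + b + t)               ≡⟨ sym (nth-factor (i + a + b) (subst (t <_) t+s (s≤s (m≤m+n t s)))) ⟩
      nth (factor w (i + a + b) a) t  ≡⟨ cong (λ l → nth l t) eq ⟩
      nth (reverse (factor w i a)) t  ≡⟨ nth-reverse (factor w i a) (trans t+s (sym (length-map-upTo _ a))) ⟩
      nth (factor w i a) s            ≡⟨ nth-factor i (subst (s <_) t+s (s≤s (m≤n+m s t))) ⟩
      w (i + s)                       ∎
      where open ≡-Reasoning

-- The certificates for k = 4, 8 and 12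

decoded-free : ∀ {K L} → Certificate K L → UndirectedFreePlus (3 + K) (2 + K) (wordW (4 + K))
decoded-free {K} cert = Avoidance.undirected-free cert F-bin occ-f occ-g
    (Decoding.decoded (suc K) T (Coded.T-code uniform F-bin occ-f occ-g) start-sorted start-perm)
  where
  open Certificate cert
  open Encoding uniform

-- The tables τ below conjugate the action of f(1), f(2) to that of 1, 2; the renaming ρ of
-- the letters makes the composite fix the initial ranking.
permute : List ℕ → List ℕ → List ℕ
permute is s = map (nth s) is

relabel : List ℕ → List ℕ → List ℕ → List ℕ
relabel is hs s = permute is (map (nth hs) s)

Intertwines : ℕ → List ℕ → List ℕ → ℕ → List ℕ → Set
Intertwines k is hs x s = mvs (g* (fOf k x)) (relabel is hs s) ≡ relabel is hs (mvs (g x) s)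

-- Matching a vector of fixed length leaves a single case, in which an identity between
-- rearrangements of variables holds by computation.
for-lists : ∀ {k} (P : List ℕ → Set) → (∀ (v : Vec ℕ k) → P (toList v)) → ∀ s → length s ≡ k → P s
for-lists P all-vecs s refl = subst P (toList∘fromList s) (all-vecs (fromList s))

relabel-injective : ∀ {k} is is′ hs hs′ →
  (∀ s → length s ≡ k → permute is′ (permute is s) ≡ s) →
  All (λ x → nth hs′ (nth hs x) ≡ x) (alphabet k) →
  ∀ {s s′} → s ↭ alphabet k → s′ ↭ alphabet k →
  relabel is hs s ≡ relabel is hs s′ → s ≡ s′
relabel-injective {k} is is′ hs hs′ undo inverse {s} {s′} p p′ eq =
  trans (sym (unlabel p)) (trans (cong (map (nth hs′)) labelled) (unlabel p′))
  where
  len : ∀ {s} → s ↭ alphabet k → length (map (nth hs) s) ≡ k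
  len {s} p = trans (length-map (nth hs) s) (trans (↭-length p) (trans (length-map suc (upTo k)) (length-upTo k)))
  labelled : map (nth hs) s ≡ map (nth hs) s′
  labelled = trans (sym (undo _ (len p))) (trans (cong (permute is′) eq) (undo _ (len p′)))
  unlabel : ∀ {s} → s ↭ alphabet k → map (nth hs′) (map (nth hs) s) ≡ s
  unlabel {s} p = trans (sym (map-∘ s)) (map-id-local (All-resp-↭ (↭-sym p) inverse))

binary? : ∀ x → Dec (Binary x)
binary? x = (x ≟ 1) ⊎-dec (x ≟ 2)

sorted? : ∀ p s → Dec (ByRecency p s)
sorted? p = allPairs? (λ a b → lastPos a p <? lastPos b p)

-- τ lists places counted from 0. ρ is indexed by letters, so its entry 0 is a dummy; the others are
-- forced by τ and `E-start`.
τ4 τ4⁻¹ ρ4 ρ4⁻¹ : List ℕ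
τ4   = 0 ∷ 3 ∷ 1 ∷ 2 ∷ []
τ4⁻¹ = 0 ∷ 2 ∷ 3 ∷ 1 ∷ []
ρ4   = 0 ∷ 2 ∷ 3 ∷ 1 ∷ 4 ∷ []
ρ4⁻¹ = 0 ∷ 3 ∷ 1 ∷ 2 ∷ 4 ∷ []

uniform4 : Uniform (fOf 4) 3
uniform4 = record
  { 2≤L    = s≤s (s≤s z≤n)
  ; f-len  = λ { (inj₁ refl) → refl ; (inj₂ refl) → refl }
  ; f-bin  = λ { (inj₁ refl) → toWitness {a? = All.all? binary? (fOf 4 1)} _
             ; (inj₂ refl) → toWitness {a? = All.all? binary? (fOf 4 2)} _ }
  ; f-head = _ , refl
  }

undo4 : ∀ s → length s ≡ 4 → permute τ4⁻¹ (permute τ4 s) ≡ s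
undo4 = for-lists (λ s → permute τ4⁻¹ (permute τ4 s) ≡ s)
  λ { (x1 ∷ x2 ∷ x3 ∷ x4 ∷ []) → refl }

intertwines4 : ∀ {x} → Binary x → ∀ s → length s ≡ 4 → Intertwines 4 τ4 ρ4 x s
intertwines4 (inj₁ refl) = for-lists (Intertwines 4 τ4 ρ4 1)
  λ { (x1 ∷ x2 ∷ x3 ∷ x4 ∷ []) → refl }
intertwines4 (inj₂ refl) = for-lists (Intertwines 4 τ4 ρ4 2)
  λ { (x1 ∷ x2 ∷ x3 ∷ x4 ∷ []) → refl }

certificate4 : Certificate 0 3
certificate4 = record
  { uniform     = uniform4
  ; last-differ = λ ()
  ; phase-len   = refl
  ; phase-ok    = refl
  ; N = 22 ; jN = 2
  ; mirror-len  = refl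
  ; mirror-ok   = refl
  ; start-sorted = toWitness {a? = sorted? (map suc (upTo 3)) (4 ∷ map suc (upTo 3))} _
  ; start-perm  = ∷↭∷ʳ 4 (map suc (upTo 3))
  ; E           = relabel τ4 ρ4
  ; E-injective = relabel-injective τ4 τ4⁻¹ ρ4 ρ4⁻¹ undo4 (refl ∷ refl ∷ refl ∷ refl ∷ [])
  ; E-start     = refl
  ; E-act       = intertwines4
  -- A positive `slack` needs `A₂ / A₁` below 2/(3(k-2)), here 1/3. `jA` is the least exponent for
  -- which two blocks satisfy `kernel-len`.
  ; A₁ = 10 ; A₂ = 3 ; jA = 4
  ; kernel-len  = refl ∷ refl ∷ refl ∷ refl ∷ []
  ; kernel-ok   = refl ∷ refl ∷ refl ∷ refl ∷ []
  -- `a₀` is the least value that `a₀-large` admits, 2 · 10 · 4 / 2; the other two certificates also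
  -- attain equality there.
  ; slack = 2 ; a₀ = 40
  ; slack≡      = refl
  ; a₀-large    = ≤ᵇ⇒≤ _ _ _
  ; k+4≤a₀      = ≤ᵇ⇒≤ _ _ _
  ; jW = 4
  ; model-len   = refl ∷ refl ∷ refl ∷ refl ∷ []
  ; repeat-ok   = refl ∷ refl ∷ refl ∷ refl ∷ []
  ; reverse-ok  = refl ∷ refl ∷ refl ∷ refl ∷ []
  }

τ8 τ8⁻¹ ρ8 ρ8⁻¹ : List ℕ
τ8   = 2 ∷ 7 ∷ 4 ∷ 5 ∷ 3 ∷ 6 ∷ 0 ∷ 1 ∷ []
τ8⁻¹ = 6 ∷ 7 ∷ 0 ∷ 4 ∷ 2 ∷ 3 ∷ 5 ∷ 1 ∷ []
ρ8   = 0 ∷ 7 ∷ 8 ∷ 4 ∷ 2 ∷ 3 ∷ 5 ∷ 1 ∷ 6 ∷ []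
ρ8⁻¹ = 0 ∷ 7 ∷ 4 ∷ 5 ∷ 3 ∷ 6 ∷ 8 ∷ 1 ∷ 2 ∷ []

uniform8 : Uniform (fOf 8) 15
uniform8 = record
  { 2≤L    = s≤s (s≤s z≤n)
  ; f-len  = λ { (inj₁ refl) → refl ; (inj₂ refl) → refl }
  ; f-bin  = λ { (inj₁ refl) → toWitness {a? = All.all? binary? (fOf 8 1)} _
             ; (inj₂ refl) → toWitness {a? = All.all? binary? (fOf 8 2)} _ }
  ; f-head = _ , refl
  }

undo8 : ∀ s → length s ≡ 8 → permute τ8⁻¹ (permute τ8 s) ≡ s
undo8 = for-lists (λ s → permute τ8⁻¹ (permute τ8 s) ≡ s)
  λ { (x1 ∷ x2 ∷ x3 ∷ x4 ∷ x5 ∷ x6 ∷ x7 ∷ x8 ∷ []) → refl }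

intertwines8 : ∀ {x} → Binary x → ∀ s → length s ≡ 8 → Intertwines 8 τ8 ρ8 x s
intertwines8 (inj₁ refl) = for-lists (Intertwines 8 τ8 ρ8 1)
  λ { (x1 ∷ x2 ∷ x3 ∷ x4 ∷ x5 ∷ x6 ∷ x7 ∷ x8 ∷ []) → refl }
intertwines8 (inj₂ refl) = for-lists (Intertwines 8 τ8 ρ8 2)
  λ { (x1 ∷ x2 ∷ x3 ∷ x4 ∷ x5 ∷ x6 ∷ x7 ∷ x8 ∷ []) → refl }

certificate8 : Certificate 4 15
certificate8 = record
  { uniform     = uniform8
  ; last-differ = λ ()
  ; phase-len   = refl
  ; phase-ok    = refl
  ; N = 61 ; jN = 1
  ; mirror-len  = refl
  ; mirror-ok   = refl
  ; start-sorted = toWitness {a? = sorted? (map suc (upTo 7)) (8 ∷ map suc (upTo 7))} _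
  ; start-perm  = ∷↭∷ʳ 8 (map suc (upTo 7))
  ; E           = relabel τ8 ρ8
  ; E-injective = relabel-injective τ8 τ8⁻¹ ρ8 ρ8⁻¹ undo8 (refl ∷ refl ∷ refl ∷ refl ∷ refl ∷ refl ∷ refl ∷ refl ∷ [])
  ; E-start     = refl
  ; E-act       = intertwines8
  ; A₁ = 12 ; A₂ = 1 ; jA = 2
  ; kernel-len  = refl ∷ refl ∷ refl ∷ refl ∷ []
  ; kernel-ok   = refl ∷ refl ∷ refl ∷ refl ∷ []
  ; slack = 6 ; a₀ = 32
  ; slack≡      = refl
  ; a₀-large    = ≤ᵇ⇒≤ _ _ _
  ; k+4≤a₀      = ≤ᵇ⇒≤ _ _ _
  ; jW = 2
  ; model-len   = refl ∷ refl ∷ refl ∷ refl ∷ []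
  ; repeat-ok   = refl ∷ refl ∷ refl ∷ refl ∷ []
  ; reverse-ok  = refl ∷ refl ∷ refl ∷ refl ∷ []
  }

τ12 τ12⁻¹ ρ12 ρ12⁻¹ : List ℕ
τ12   = 5 ∷ 3 ∷ 9 ∷ 1 ∷ 11 ∷ 0 ∷ 7 ∷ 4 ∷ 10 ∷ 6 ∷ 8 ∷ 2 ∷ []
τ12⁻¹ = 5 ∷ 3 ∷ 11 ∷ 1 ∷ 7 ∷ 0 ∷ 9 ∷ 6 ∷ 10 ∷ 2 ∷ 8 ∷ 4 ∷ []
ρ12   = 0 ∷ 3 ∷ 11 ∷ 1 ∷ 7 ∷ 12 ∷ 9 ∷ 6 ∷ 10 ∷ 2 ∷ 8 ∷ 4 ∷ 5 ∷ []
ρ12⁻¹ = 0 ∷ 3 ∷ 9 ∷ 1 ∷ 11 ∷ 12 ∷ 7 ∷ 4 ∷ 10 ∷ 6 ∷ 8 ∷ 2 ∷ 5 ∷ []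

uniform12 : Uniform (fOf 12) 21
uniform12 = record
  { 2≤L    = s≤s (s≤s z≤n)
  ; f-len  = λ { (inj₁ refl) → refl ; (inj₂ refl) → refl }
  ; f-bin  = λ { (inj₁ refl) → toWitness {a? = All.all? binary? (fOf 12 1)} _
             ; (inj₂ refl) → toWitness {a? = All.all? binary? (fOf 12 2)} _ }
  ; f-head = _ , refl
  }

undo12 : ∀ s → length s ≡ 12 → permute τ12⁻¹ (permute τ12 s) ≡ s
undo12 = for-lists (λ s → permute τ12⁻¹ (permute τ12 s) ≡ s)
  λ { (x1 ∷ x2 ∷ x3 ∷ x4 ∷ x5 ∷ x6 ∷ x7 ∷ x8 ∷ x9 ∷ x10 ∷ x11 ∷ x12 ∷ []) → refl }

intertwines12 : ∀ {x} → Binary x → ∀ s → length s ≡ 12 → Intertwines 12 τ12 ρ12 x s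
intertwines12 (inj₁ refl) = for-lists (Intertwines 12 τ12 ρ12 1)
  λ { (x1 ∷ x2 ∷ x3 ∷ x4 ∷ x5 ∷ x6 ∷ x7 ∷ x8 ∷ x9 ∷ x10 ∷ x11 ∷ x12 ∷ []) → refl }
intertwines12 (inj₂ refl) = for-lists (Intertwines 12 τ12 ρ12 2)
  λ { (x1 ∷ x2 ∷ x3 ∷ x4 ∷ x5 ∷ x6 ∷ x7 ∷ x8 ∷ x9 ∷ x10 ∷ x11 ∷ x12 ∷ []) → refl }

certificate12 : Certificate 8 21
certificate12 = record
  { uniform     = uniform12
  ; last-differ = λ ()
  ; phase-len   = refl
  ; phase-ok    = refl
  ; N = 51 ; jN = 1
  ; mirror-len  = refl
  ; mirror-ok   = refl
  ; start-sorted = toWitness {a? = sorted? (map suc (upTo 11)) (12 ∷ map suc (upTo 11))} _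
  ; start-perm  = ∷↭∷ʳ 12 (map suc (upTo 11))
  ; E           = relabel τ12 ρ12
  ; E-injective = relabel-injective τ12 τ12⁻¹ ρ12 ρ12⁻¹ undo12 (refl ∷ refl ∷ refl ∷ refl ∷ refl ∷ refl ∷ refl ∷ refl ∷ refl ∷ refl ∷ refl ∷ refl ∷ [])
  ; E-start     = refl
  ; E-act       = intertwines12
  ; A₁ = 20 ; A₂ = 1 ; jA = 2
  ; kernel-len  = refl ∷ refl ∷ refl ∷ refl ∷ []
  ; kernel-ok   = refl ∷ refl ∷ refl ∷ refl ∷ []
  ; slack = 10 ; a₀ = 48
  ; slack≡      = refl
  ; a₀-large    = ≤ᵇ⇒≤ _ _ _
  ; k+4≤a₀      = ≤ᵇ⇒≤ _ _ _
  ; jW = 2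
  ; model-len   = refl ∷ refl ∷ refl ∷ refl ∷ []
  ; repeat-ok   = refl ∷ refl ∷ refl ∷ refl ∷ []
  ; reverse-ok  = refl ∷ refl ∷ refl ∷ refl ∷ []
  }

theorem6 : (k : ℕ) → k ≡ 4 ⊎ k ≡ 8 ⊎ k ≡ 12 →
    UndirectedFreePlus (k ∸ 1) (k ∸ 2) (wordW k)
theorem6 _ (inj₁ refl)        = decoded-free certificate4
theorem6 _ (inj₂ (inj₁ refl)) = decoded-free certificate8
theorem6 _ (inj₂ (inj₂ refl)) = decoded-free certificate12
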